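{- For any $A,B,B',C,C'\in\widehat{\mathbb{F}_q}$ and any $x,y\in\mathbb{F}_q$, $$F_{2}(A;B,B';C,C';x,y)=\frac{1}{(q-1)^2}\sum_{\chi,\lambda}\binom{A\chi}{\chi}\binom{A\chi\lambda}{\lambda}\binom{B\chi}{C\chi}\binom{B'\lambda}{C'\lambda}\chi(x)\lambda(y)+\overline{A}(-x)\,\overline{C'}(y)\,\overline{B'}C'(1-y)\binom{\overline{A}B}{B\overline{C}},$$ where $\chi$ and $\lambda$ each range over all multiplicative characters of $\mathbb{F}_q$.
   Context: Let $q$ be a power of a prime, $\mathbb{F}_q$ the field with $q$ elements, and $\widehat{\mathbb{F}_q}$ the group of (complex-valued) multiplicative characters of $\mathbb{F}_q^*$. Every character $\chi$, including the trivial character $\varepsilon$, is extended to $\mathbb{F}_q$ by $\chi(0)=0$. $\overline{\chi}$ denotes the inverse of $\chi$. Products of characters are evaluated pointwise, e.g. $\overline{B'}C'(1-y)=\overline{B'}(1-y)C'(1-y)$ and $BC(-1)=B(-1)C(-1)$. Jacobi sum: $J(\chi,\lambda)=\sum_{u\in\mathbb{F}_q}\chi(u)\lambda(1-u)$. Binomial coefficient of characters: $\binom{A}{B}=B(-1)J(A,\overline{B})$. The finite field Appell series $F_2$ is defined, for $A,B,B',C,C'\in\widehat{\mathbb{F}_q}$ and $x,y\in\mathbb{F}_q$, by $$F_{2}(A;B,B';C,C';x,y)=\varepsilon(xy)\,BB'CC'(-1)\sum_{u,v\in\mathbb{F}_q}B(u)B'(v)\,\overline{B}C(1-u)\,\overline{B'}C'(1-v)\,\overline{A}(1-ux-vy).$$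 -}

module Defs where

open import Algebra.Apartness.Bundles using (HeytingField)
open import Algebra.Bundles using (AbelianGroup; CommutativeRing)
open import Algebra.Definitions using (Invertible)
open import Algebra.Morphism.Bundles using (GroupHomomorphism)
import Algebra.Properties.AbelianGroup as AbelianGroupProperties
import Algebra.Properties.CommutativeSemigroup as CommutativeSemigroupProperties
import Algebra.Properties.Monoid.Mult as Mult
import Algebra.Properties.Monoid.Sum as Sum
import Algebra.Properties.Semiring.Exp as Exp
open import Data.Fin.Base using (Fin; toℕ)
import Data.Fin.Properties as Fin
open import Data.Nat.Base as ℕ using (ℕ; zero; suc; NonZero; nonTrivial⇒n>1)
import Data.Nat.Properties as ℕ
open import Data.Nat.Primality using (Prime; prime⇒nonZero; prime⇒nonTrivial)
open import Data.Product.Base using (∃-syntax; _×_; _,_; proj₁; proj₂)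
open import Data.Vec.Functional using (Vector)
open import Function.Bundles using (Inverse)
open import Function.Properties.Inverse using (Inverse⇒Injection) renaming (sym to ↔-sym)
open import Level using (Level; _⊔_) renaming (suc to lsuc)
open import Relation.Binary.Bundles using (Setoid)
open import Relation.Binary.Definitions using (Decidable)
open import Relation.Binary.PropositionalEquality as ≡ using (_≡_; refl)
import Relation.Binary.Reasoning.Setoid as SetoidReasoning
open import Relation.Nullary using (¬_; yes; no)
open import Relation.Nullary.Decidable using (via-injection)

------------------------------------------------------------------------
-- Fields

IsPrimePower : ℕ → Set
IsPrimePower q = ∃[ p ] ∃[ k ] Prime p × q ≡ p ℕ.^ suc k

primePower⇒q∸1≢0 : ∀ {q} → IsPrimePower q → NonZero (q ℕ.∸ 1)
primePower⇒q∸1≢0 (p , k , pr , refl) =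
  ℕ.>-nonZero (ℕ.m<n⇒0<n∸m (ℕ.<-≤-trans 1<p p≤p^[1+k]))
  where
  instance _ = prime⇒nonZero pr
  1<p : 1 ℕ.< p
  1<p = nonTrivial⇒n>1 p {{prime⇒nonTrivial pr}}
  p≤p^[1+k] : p ℕ.≤ p ℕ.^ suc k
  p≤p^[1+k] = ℕ.m≤m*n p (p ℕ.^ k) {{ℕ.m^n≢0 p k}}

record FiniteField c ℓ (q : ℕ) : Set (lsuc (c ⊔ ℓ)) where
  field
    commutativeRing : CommutativeRing c ℓ
  open CommutativeRing commutativeRing public
  field
    0≉1           : ¬ (0# ≈ 1#)
    ≉0⇒invertible : ∀ x → ¬ (x ≈ 0#) → Invertible _≈_ 1# _*_ x
    elements      : Inverse (≡.setoid (Fin q)) setoid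

  infix 4 _≟_
  _≟_ : Decidable _≈_
  _≟_ = via-injection (Inverse⇒Injection (↔-sym elements)) Fin._≟_

-- The field ℂ in which characters take their values enters only through
-- being algebraically closed of characteristic 0, so we work over an
-- arbitrary such field.  Decidable equality is not required, since ℂ does not
-- have it constructively; x # 0# expresses that x is invertible.
record AlgClosedCharZeroField c ℓ₁ ℓ₂ : Set (lsuc (c ⊔ ℓ₁ ⊔ ℓ₂)) where
  field
    heytingField : HeytingField c ℓ₁ ℓ₂
  open HeytingField heytingField public

  commutativeRing : CommutativeRing c ℓ₁
  commutativeRing = record { isCommutativeRing = isCommutativeRing }

  open CommutativeRing commutativeRing public using (semiring; +-monoid)
  open Mult +-monoid public using () renaming (_×_ to _×ₙ_)
  open Sum +-monoid public using (sum; sum-syntax)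
  open Exp semiring public using (_^_)
  field
    charZero : ∀ n → suc n ×ₙ 1# # 0#
    -- every monic polynomial z^(n+1) + a_n z^n + … + a_0 has a root
    algClosed : ∀ n (a : Vector Carrier (suc n)) →
                ∃[ z ] z ^ suc n + sum (λ i → a i * z ^ toℕ i) ≈ 0#

  -- #⇒invertible inverts n ×ₙ 1# - 0#, the apartness being one from 0#.
  1/_ : ∀ n .{{_ : NonZero n}} → Carrier
  1/ suc n = proj₁ (#⇒invertible (charZero n))

------------------------------------------------------------------------
-- Unit groups

module _ {c ℓ} (R : CommutativeRing c ℓ) where
  open CommutativeRing R hiding (refl; sym; trans)
  private
    module R = CommutativeRing R
  open CommutativeSemigroupProperties *-commutativeSemigroup using (interchange)
  open SetoidReasoning setoid

  unitGroup : AbelianGroup (c ⊔ ℓ) ℓ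
  unitGroup = record
    { Carrier = ∃[ x ] Invertible _≈_ 1# _*_ x
    ; _≈_     = λ x y → proj₁ x ≈ proj₁ y
    ; _∙_     = λ (x , x′ , p , p′) (y , y′ , r , r′) →
                  x * y , x′ * y′ , prod p r , prod p′ r′
    ; ε       = 1# , 1# , *-identityˡ 1# , *-identityˡ 1#
    ; _⁻¹     = λ (x , x′ , p , p′) → x′ , x , p′ , p
    ; isAbelianGroup = record
      { isGroup = record
        { isMonoid = record
          { isSemigroup = record
            { isMagma = record
              { isEquivalence = record
                { refl = R.refl ; sym = R.sym ; trans = R.trans }
              ; ∙-cong = *-cong
              }
            ; assoc = λ x y z → *-assoc (proj₁ x) (proj₁ y) (proj₁ z)
            }
          ; identity = (λ x → *-identityˡ (proj₁ x)) , (λ x → *-identityʳ (proj₁ x))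
          }
        ; inverse = (λ (_ , _ , p , _) → p) , (λ (_ , _ , _ , p′) → p′)
        ; ⁻¹-cong = λ {(x , x′ , p , _)} {(y , y′ , _ , r′)} x≈y → begin
            x′              ≈⟨ *-identityʳ x′ ⟨
            x′ * 1#         ≈⟨ *-congˡ r′ ⟨
            x′ * (y * y′)   ≈⟨ *-assoc x′ y y′ ⟨
            x′ * y * y′     ≈⟨ *-congʳ (*-congˡ x≈y) ⟨
            x′ * x * y′     ≈⟨ *-congʳ p ⟩
            1# * y′         ≈⟨ *-identityˡ y′ ⟩
            y′              ∎
        }
      ; comm = λ x y → *-comm (proj₁ x) (proj₁ y)
      }
    }
    where
    prod : ∀ {x x′ y y′} → x * x′ ≈ 1# → y * y′ ≈ 1# → (x * y) * (x′ * y′) ≈ 1#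
    prod {x} {x′} {y} {y′} p r = begin
      (x * y) * (x′ * y′) ≈⟨ interchange x y x′ y′ ⟩
      (x * x′) * (y * y′) ≈⟨ *-cong p r ⟩
      1# * 1#             ≈⟨ *-identityˡ 1# ⟩
      1#                  ∎

------------------------------------------------------------------------
-- Multiplicative characters, Jacobi sums and the Appell series F₂

module Characters {c ℓ q k ℓ₁ ℓ₂}
  (𝔽 : FiniteField c ℓ q) (K : AlgClosedCharZeroField k ℓ₁ ℓ₂) where

  private
    module F = FiniteField 𝔽
    module 𝕂 = AlgClosedCharZeroField K
    module F× = AbelianGroup (unitGroup F.commutativeRing)
    module 𝕂× where
      open AbelianGroup (unitGroup 𝕂.commutativeRing) public
      open AbelianGroupProperties (unitGroup 𝕂.commutativeRing) public
        using (⁻¹-∙-comm; ε⁻¹≈ε)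
      open CommutativeSemigroupProperties commutativeSemigroup public
        using (interchange)
  open 𝕂 using (_+_; _*_; _^_; 1/_)

  Character : Set (c ⊔ ℓ ⊔ k ⊔ ℓ₁)
  Character = GroupHomomorphism F×.rawGroup 𝕂×.rawGroup

  open GroupHomomorphism using (⟦_⟧; ⟦⟧-cong; homo; ε-homo; ⁻¹-homo)

  characterSetoid : Setoid (c ⊔ ℓ ⊔ k ⊔ ℓ₁) (c ⊔ ℓ ⊔ ℓ₁)
  characterSetoid = record
    { Carrier = Character
    ; _≈_     = λ χ ψ → ∀ x → ⟦ χ ⟧ x 𝕂×.≈ ⟦ ψ ⟧ x
    ; isEquivalence = record
      { refl  = λ {χ} x → 𝕂×.refl {⟦ χ ⟧ x}
      ; sym   = λ {χ} {ψ} p x → 𝕂×.sym {⟦ χ ⟧ x} {⟦ ψ ⟧ x} (p x)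
      ; trans = λ {χ} {ψ} {φ} p r x →
                  𝕂×.trans {⟦ χ ⟧ x} {⟦ ψ ⟧ x} {⟦ φ ⟧ x} (p x) (r x)
      }
    }

  private
    mkCharacter : (f : F×.Carrier → 𝕂×.Carrier) →
      (∀ {x y} → x F×.≈ y → f x 𝕂×.≈ f y) →
      (∀ x y → f (x F×.∙ y) 𝕂×.≈ f x 𝕂×.∙ f y) →
      f F×.ε 𝕂×.≈ 𝕂×.ε →
      (∀ x → f (x F×.⁻¹) 𝕂×.≈ f x 𝕂×.⁻¹) →
      Character
    mkCharacter f f-cong f-homo f-ε f-⁻¹ = record
      { ⟦_⟧ = f
      ; isGroupHomomorphism = record
        { isMonoidHomomorphism = record
          { isMagmaHomomorphism = record
            { isRelHomomorphism = record { cong = λ {x} {y} → f-cong {x} {y} }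
            ; homo = f-homo
            }
          ; ε-homo = f-ε
          }
        ; ⁻¹-homo = f-⁻¹
        }
      }

  infixl 7 _·_
  infix  8 _⁻¹

  ε : Character
  ε = mkCharacter (λ _ → 𝕂×.ε) (λ _ → 𝕂.refl)
    (λ _ _ → 𝕂×.sym {𝕂×.ε 𝕂×.∙ 𝕂×.ε} {𝕂×.ε} (𝕂×.identityˡ 𝕂×.ε))
    𝕂.refl (λ _ → 𝕂.refl)

  _·_ : Character → Character → Character
  χ · ψ = mkCharacter (λ x → ⟦ χ ⟧ x 𝕂×.∙ ⟦ ψ ⟧ x)
    (λ {x} {y} x≈y → ∙-cong (χ ⟨⟩ x) (χ ⟨⟩ y) (ψ ⟨⟩ x) (ψ ⟨⟩ y)
      (⟦⟧-cong χ {x} {y} x≈y) (⟦⟧-cong ψ {x} {y} x≈y))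
    (λ x y → 𝕂.trans
      (∙-cong (χ ⟨⟩ (x F×.∙ y)) (χ ⟨⟩ x 𝕂×.∙ χ ⟨⟩ y)
              (ψ ⟨⟩ (x F×.∙ y)) (ψ ⟨⟩ x 𝕂×.∙ ψ ⟨⟩ y) (homo χ x y) (homo ψ x y))
      (𝕂×.interchange (χ ⟨⟩ x) (χ ⟨⟩ y) (ψ ⟨⟩ x) (ψ ⟨⟩ y)))
    (𝕂.trans
      (∙-cong (χ ⟨⟩ F×.ε) 𝕂×.ε (ψ ⟨⟩ F×.ε) 𝕂×.ε (ε-homo χ) (ε-homo ψ))
      (𝕂×.identityˡ 𝕂×.ε))
    (λ x → 𝕂.trans
      (∙-cong (χ ⟨⟩ (x F×.⁻¹)) ((χ ⟨⟩ x) 𝕂×.⁻¹) (ψ ⟨⟩ (x F×.⁻¹)) ((ψ ⟨⟩ x) 𝕂×.⁻¹)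
        (⁻¹-homo χ x) (⁻¹-homo ψ x))
      (𝕂×.⁻¹-∙-comm (χ ⟨⟩ x) (ψ ⟨⟩ x)))
    where
    _⟨⟩_ = ⟦_⟧
    ∙-cong : ∀ a a′ b b′ → a 𝕂×.≈ a′ → b 𝕂×.≈ b′ → a 𝕂×.∙ b 𝕂×.≈ a′ 𝕂×.∙ b′
    ∙-cong a a′ b b′ = 𝕂×.∙-cong {a} {a′} {b} {b′}

  _⁻¹ : Character → Character
  χ ⁻¹ = mkCharacter (λ x → ⟦ χ ⟧ x 𝕂×.⁻¹)
    (λ {x} {y} x≈y → ⁻¹-cong (⟦ χ ⟧ x) (⟦ χ ⟧ y) (⟦⟧-cong χ {x} {y} x≈y))
    (λ x y → 𝕂.trans
      (⁻¹-cong (⟦ χ ⟧ (x F×.∙ y)) (⟦ χ ⟧ x 𝕂×.∙ ⟦ χ ⟧ y) (homo χ x y))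
      (𝕂.sym (𝕂×.⁻¹-∙-comm (⟦ χ ⟧ x) (⟦ χ ⟧ y))))
    (𝕂.trans (⁻¹-cong (⟦ χ ⟧ F×.ε) 𝕂×.ε (ε-homo χ)) 𝕂×.ε⁻¹≈ε)
    (λ x → ⁻¹-cong (⟦ χ ⟧ (x F×.⁻¹)) (⟦ χ ⟧ x 𝕂×.⁻¹) (⁻¹-homo χ x))
    where
    ⁻¹-cong : ∀ a b → a 𝕂×.≈ b → a 𝕂×.⁻¹ 𝕂×.≈ b 𝕂×.⁻¹
    ⁻¹-cong a b = 𝕂×.⁻¹-cong {a} {b}

  -- χ ⟨ x ⟩ is the value at x of χ extended to 𝔽 by χ(0) = 0.
  infix 9 _⟨_⟩
  _⟨_⟩ : Character → F.Carrier → 𝕂.Carrier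
  χ ⟨ x ⟩ with x F.≟ F.0#
  ... | yes _  = 𝕂.0#
  ... | no x≉0 = proj₁ (⟦ χ ⟧ (x , F.≉0⇒invertible x x≉0))

  ∑𝔽 : (F.Carrier → 𝕂.Carrier) → 𝕂.Carrier
  ∑𝔽 f = 𝕂.∑[ i < q ] f (Inverse.to F.elements i)

  -- A listing of the character group without repetition, which gives meaning
  -- to sums over all characters; that it has q - 1 terms is not assumed.
  record CharacterEnumeration : Set (c ⊔ ℓ ⊔ k ⊔ ℓ₁) where
    field
      size       : ℕ
      characters : Inverse (≡.setoid (Fin size)) characterSetoid

    ∑χ : (Character → 𝕂.Carrier) → 𝕂.Carrier
    ∑χ f = 𝕂.∑[ i < size ] f (Inverse.to characters i)

  -1F : F.Carrier
  -1F = F.- F.1#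

  J : Character → Character → 𝕂.Carrier
  J χ ψ = ∑𝔽 λ u → χ ⟨ u ⟩ * ψ ⟨ F.1# F.- u ⟩

  binom : Character → Character → 𝕂.Carrier
  binom A B = B ⟨ -1F ⟩ * J A (B ⁻¹)

  F₂ : (A B B′ C C′ : Character) (x y : F.Carrier) → 𝕂.Carrier
  F₂ A B B′ C C′ x y =
    ε ⟨ x F.* y ⟩ * (B · B′ · C · C′) ⟨ -1F ⟩ *
    ∑𝔽 λ u → ∑𝔽 λ v →
      B ⟨ u ⟩ * B′ ⟨ v ⟩ * (B ⁻¹ · C) ⟨ F.1# F.- u ⟩ *
      (B′ ⁻¹ · C′) ⟨ F.1# F.- v ⟩ *
      (A ⁻¹) ⟨ F.1# F.- u F.* x F.- v F.* y ⟩

{-# OPTIONS --safe #-}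
module Submission where

-- By orthogonality of characters, averaging binom (Aχ) χ · χ(x) over all χ
-- gives ε(x) A⁻¹(1 - x).  Up to sign, binom (Bχ) (Cχ) is the Jacobi-type sum
-- of B(u) B⁻¹C(1 - u) χ(u) over u.  Inserting this and the analogous formula
-- with v for binom (B′ψ) (C′ψ), and averaging over ψ and then over χ, produces
-- the summand of F₂, except that Aχ inverse vanishes at 1 - v y for every χ
-- when v y = 1, although A⁻¹(1 - u x - v y) need not vanish.  The terms with
-- v y = 1 make up the correction term.
--
-- Orthogonality needs, for x ≠ 1, a character with χ(x) ≠ 1.  It is obtained
-- by choosing a nontrivial root of unity as its value at x and extending from
-- a subgroup to the subgroup generated by one further element, with roots
-- supplied by K.  Equality in K is not decidable, but it is stable because the
-- apartness is tight: a sum that is invariant under multiplication by some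
-- a ≉ 1 cannot be apart from 0.

open import Defs
open import Algebra.Bundles using (AbelianGroup; CommutativeRing)
open import Algebra.Morphism.Bundles using (GroupHomomorphism)
import Algebra.Properties.CommutativeMonoid.Sum as CommutativeMonoidSum
import Algebra.Properties.CommutativeSemigroup as CommutativeSemigroupProperties
import Algebra.Properties.CommutativeSemiring.Exp as CommutativeSemiringExp
import Algebra.Properties.Group as GroupProperties
import Algebra.Properties.Monoid.Mult as Mult
import Algebra.Properties.Monoid.Sum as Sum
import Algebra.Properties.Ring as RingProperties
import Algebra.Properties.Semiring.Exp as Exp
import Algebra.Properties.Semiring.Sum as SemiringSum
import Algebra.Solver.CommutativeMonoid as CommutativeMonoidSolver
open import Data.Fin.Base as Fin using (Fin; zero; suc; toℕ; fromℕ<; punchIn)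
open import Data.Fin.Permutation using (permutation)
import Data.Fin.Properties as Fin
open import Data.Nat.Base as ℕ using (ℕ; zero; suc; _∸_; NonZero)
open import Data.Nat.DivMod using (_%_; _/_; m≡m%n+[m/n]*n; m%n<n)
import Data.Nat.Properties as ℕ
open import Data.Product.Base using (∃-syntax; _×_; _,_; proj₁; proj₂)
open import Data.Sum.Base using (_⊎_; inj₁; inj₂)
open import Data.Vec.Functional using (Vector; replicate; removeAt)
open import Function.Base using (_∘_)
open import Function.Bundles using (Inverse)
open import Function.Properties.Inverse using (Inverse⇒Injection) renaming (sym to ↔-sym)
open import Level using (Level; _⊔_) renaming (suc to lsuc)
open import Relation.Binary.Bundles using (Setoid)
open import Relation.Binary.Definitions using (Decidable)
open import Relation.Binary.PropositionalEquality as ≡ using (_≡_; _≢_; refl)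
import Relation.Binary.Reasoning.Setoid as SetoidReasoning
open import Relation.Nullary using (¬_; Dec; yes; no; contradiction)
open import Relation.Nullary.Decidable using (map′; ¬?; decidable-stable; toSum; via-injection)

-- Roots and roots of unity in the value field

module _ {k ℓ₁ ℓ₂} (K : AlgClosedCharZeroField k ℓ₁ ℓ₂) where
  open AlgClosedCharZeroField K
  open CommutativeRing commutativeRing
    using (+-group)
  open Exp semiring hiding (_^_)
  open GroupProperties +-group using (∙-cancelʳ)
  open SetoidReasoning setoid

  ^-zeroˡ : ∀ n → 1# ^ n ≈ 1#
  ^-zeroˡ zero    = CommutativeRing.refl commutativeRing
  ^-zeroˡ (suc n) = trans (*-identityˡ _) (^-zeroˡ n)

  nthRoot : ∀ n c → ∃[ z ] z ^ suc n ≈ c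
  -- These are the coefficients of z^(n+1) - c.
  nthRoot n c with z , root ← algClosed n (λ { zero → - c ; (suc _) → 0# }) =
    z , ∙-cancelʳ (- c) _ _ (begin
      z ^ suc n + - c
        ≈⟨ +-congˡ (begin
          - c                      ≈⟨ +-identityʳ (- c) ⟨
          - c + 0#
            ≈⟨ +-cong (*-identityʳ (- c)) (trans
                 (Sum.sum-cong-≋ +-monoid (λ (i : Fin n) → zeroˡ (z ^ suc (toℕ i))))
                 (Sum.sum-replicate-zero +-monoid n)) ⟨
          - c * 1# + _             ∎) ⟩
      z ^ suc n + (- c * 1# + _) ≈⟨ root ⟩
      0#                         ≈⟨ -‿inverseʳ c ⟨
      c + - c                    ∎)

  -- The factor `1#` makes this literally the lower part of the polynomial that `algClosed` solves
  -- when all coefficients are 1.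
  geometricSum : Carrier → ℕ → Carrier
  geometricSum w n = ∑[ i < n ] (1# * w ^ toℕ i)

  geometricSum-head : ∀ w n → geometricSum w (suc n) ≈ 1# + w * geometricSum w n
  geometricSum-head w n = +-cong (*-identityˡ 1#) (begin
    ∑[ i < n ] (1# * (w * w ^ toℕ i))
      ≈⟨ Sum.sum-cong-≋ +-monoid (λ (i : Fin n) →
           trans (*-identityˡ _) (*-congˡ (sym (*-identityˡ (w ^ toℕ i))))) ⟩
    ∑[ i < n ] (w * (1# * w ^ toℕ i))
      ≈⟨ SemiringSum.*-distribˡ-sum semiring w (λ (i : Fin n) → 1# * w ^ toℕ i) ⟨
    w * geometricSum w n ∎)

  geometricSum-last : ∀ w n → geometricSum w (suc n) ≈ w ^ n + geometricSum w n
  geometricSum-last w zero    = +-congʳ (*-identityˡ 1#)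
  geometricSum-last w (suc n) = begin
    geometricSum w (suc (suc n))              ≈⟨ geometricSum-head w (suc n) ⟩
    1# + w * geometricSum w (suc n)           ≈⟨ +-congˡ (*-congˡ (geometricSum-last w n)) ⟩
    1# + w * (w ^ n + geometricSum w n)       ≈⟨ +-congˡ (distribˡ w _ _) ⟩
    1# + (w ^ suc n + w * geometricSum w n)   ≈⟨ +-assoc 1# _ _ ⟨
    1# + w ^ suc n + w * geometricSum w n     ≈⟨ +-congʳ (+-comm 1# _) ⟩
    w ^ suc n + 1# + w * geometricSum w n     ≈⟨ +-assoc _ 1# _ ⟩
    w ^ suc n + (1# + w * geometricSum w n)   ≈⟨ +-congˡ (geometricSum-head w n) ⟨
    w ^ suc n + geometricSum w (suc n)        ∎

  geometricSum-1 : ∀ n → geometricSum 1# n ≈ n ×ₙ 1#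
  geometricSum-1 zero    = CommutativeRing.refl commutativeRing
  geometricSum-1 (suc n) =
    trans (geometricSum-last 1# n) (+-cong (^-zeroˡ n) (geometricSum-1 n))

  -- Let w be a root of 1 + z + ... + z^(n+1). Both this sum and w times it vanish. Peeling the
  -- first term off the one and expanding the other leaves a common summand, and cancelling it gives
  -- w^(n+2) = 1. If w were 1, the sum would be n+2, which is apart from 0 in characteristic 0.
  nontrivialRootOfUnity : ∀ n → ∃[ w ] w ^ suc (suc n) ≈ 1# × ¬ w ≈ 1#
  nontrivialRootOfUnity n with w , root ← algClosed n (λ _ → 1#) =
    w , ∙-cancelʳ (w * geometricSum w m) _ _ (begin
      w * w ^ m + w * geometricSum w m ≈⟨ distribˡ w _ _ ⟨
      w * (w ^ m + geometricSum w m)   ≈⟨ *-congˡ root ⟩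
      w * 0#                           ≈⟨ zeroʳ w ⟩
      0#                               ≈⟨ root ⟨
      w ^ m + geometricSum w m         ≈⟨ geometricSum-last w m ⟨
      geometricSum w (suc m)           ≈⟨ geometricSum-head w m ⟩
      1# + w * geometricSum w m        ∎)
    , λ w≈1 → #-irrefl (begin
      suc m ×ₙ 1#                      ≈⟨ geometricSum-1 (suc m) ⟨
      geometricSum 1# (suc m)
        ≈⟨ Sum.sum-cong-≋ +-monoid (λ (i : Fin (suc m)) → *-congˡ {1#} (^-congˡ (toℕ i) w≈1)) ⟨
      geometricSum w (suc m)           ≈⟨ geometricSum-last w m ⟩
      w ^ m + geometricSum w m         ≈⟨ root ⟩
      0#                               ∎) (charZero m)
    where
    m = suc n

-- Extending characters from subgroups of a finite abelian group

module SeparatingCharacters {c ℓ k ℓ₁ ℓ₂}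
  (G : AbelianGroup c ℓ) (K : AlgClosedCharZeroField k ℓ₁ ℓ₂)
  (_≟_ : Decidable (AbelianGroup._≈_ G)) {N : ℕ}
  (element : Fin N → AbelianGroup.Carrier G)
  (index : AbelianGroup.Carrier G → Fin N)
  (element-index : ∀ x → AbelianGroup._≈_ G (element (index x)) x)
  where

  private
    module G where
      open AbelianGroup G public
      open GroupProperties group public using (∙-cancelˡ)
      open Mult monoid public
        using () renaming (_×_ to pow; ×-homo-+ to pow-+; ×-assocˡ to pow-*)
      open CommutativeSemigroupProperties commutativeSemigroup public
        using (interchange; x∙yz≈y∙xz; xy∙z≈xz∙y)
    module 𝕂 where
      open AlgClosedCharZeroField K public
      open CommutativeSemiringExp
        (CommutativeRing.commutativeSemiring commutativeRing) public
        using (^-homo-*; ^-assocʳ; ^-congˡ; ^-distrib-*)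
      open CommutativeSemigroupProperties
        (CommutativeRing.*-commutativeSemigroup commutativeRing) public using (interchange)
    module G-Reasoning = SetoidReasoning G.setoid
    module 𝕂-Reasoning = SetoidReasoning 𝕂.setoid
    pow = G.pow

  open G using (_∙_; _≈_)
  open 𝕂 using (_*_; _^_; 1#)

  -- A character of a decidable subgroup `Dom`. Closure under inverses is encoded as `Dom-cancel`,
  -- the form in which it is mostly used. Since `val` takes a membership proof, `val-cong` also says
  -- that the value does not depend on that proof.
  record PartialCharacter : Set (c ⊔ lsuc ℓ ⊔ k ⊔ ℓ₁) where
    field
      Dom        : G.Carrier → Set ℓ
      Dom?       : ∀ x → Dec (Dom x)
      Dom-resp   : ∀ {x y} → x ≈ y → Dom x → Dom y
      Dom-ε      : Dom G.ε
      Dom-∙      : ∀ {x y} → Dom x → Dom y → Dom (x ∙ y)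
      Dom-cancel : ∀ {x y} → Dom (x ∙ y) → Dom y → Dom x
      val        : ∀ {x} → Dom x → 𝕂.Carrier
      val-cong   : ∀ {x y} → x ≈ y → (p : Dom x) (r : Dom y) → val p 𝕂.≈ val r
      val-ε      : (p : Dom G.ε) → val p 𝕂.≈ 1#
      val-∙      : ∀ {x y} (p : Dom x) (r : Dom y) (s : Dom (x ∙ y)) →
                   val s 𝕂.≈ val p * val r

    Dom-⁻¹ : ∀ {x} → Dom x → Dom (x G.⁻¹)
    Dom-⁻¹ {x} p = Dom-cancel (Dom-resp (G.sym (G.inverseˡ x)) Dom-ε) p

    val-inverseˡ : ∀ {x} (p : Dom x) (r : Dom (x G.⁻¹)) → val r * val p 𝕂.≈ 1#
    val-inverseˡ {x} p r = 𝕂.trans (𝕂.sym (val-∙ r p (Dom-∙ r p)))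
      (𝕂.trans (val-cong (G.inverseˡ x) _ Dom-ε) (val-ε Dom-ε))

    Dom-pow : ∀ {x} → Dom x → ∀ n → Dom (pow n x)
    Dom-pow p zero    = Dom-ε
    Dom-pow p (suc n) = Dom-∙ p (Dom-pow p n)

    val-pow : ∀ {x} (p : Dom x) n (r : Dom (pow n x)) → val r 𝕂.≈ val p ^ n
    val-pow p zero    r = val-ε r
    val-pow p (suc n) r = 𝕂.trans (val-∙ p (Dom-pow p n) r)
      (𝕂.*-congˡ (val-pow p n (Dom-pow p n)))

    -- `suc n-1` is the order of g in the quotient by `Dom`; storing the predecessor keeps it
    -- positive.
    record Period (g : G.Carrier) : Set ℓ where
      field
        n-1     : ℕ
        isDom   : Dom (pow (suc n-1) g)
        divides : ∀ j → Dom (pow j g) → ∃[ d ] j ≡ d ℕ.* suc n-1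

  -- Among the N + 1 powers with exponents 0 to N two must have the same index, hence be equal;
  -- cancelling the smaller one leaves a positive power equal to the identity.
  torsion : ∀ g → ∃[ n ] pow (suc n) g ≈ G.ε
  torsion g with Fin.pigeonhole (ℕ.n<1+n N) (λ i → index (pow (toℕ i) g))
  ... | i , j , i<j , eq = d , G.∙-cancelˡ (pow (toℕ i) g) _ _ (begin
    pow (toℕ i) g ∙ pow (suc d) g       ≈⟨ G.pow-+ g (toℕ i) (suc d) ⟨
    pow (toℕ i ℕ.+ suc d) g             ≡⟨ ≡.cong (λ m → pow m g) i+[1+d]≡j ⟩
    pow (toℕ j) g                       ≈⟨ element-index _ ⟨
    element (index (pow (toℕ j) g))     ≡⟨ ≡.cong element eq ⟨
    element (index (pow (toℕ i) g))     ≈⟨ element-index _ ⟩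
    pow (toℕ i) g                       ≈⟨ G.identityʳ _ ⟨
    pow (toℕ i) g ∙ G.ε                 ∎)
    where
    open G-Reasoning
    -- One less than the difference of the exponents, because the power sought is `suc d`.
    d = toℕ j ∸ suc (toℕ i)
    i+[1+d]≡j : toℕ i ℕ.+ suc d ≡ toℕ j
    i+[1+d]≡j = ≡.trans (ℕ.+-suc (toℕ i) d) (ℕ.m+[n∸m]≡n i<j)

  module _ (χ : PartialCharacter) (g : G.Carrier) where
    open PartialCharacter χ

    -- Some positive power of g is the identity, so there is a least m > 0 with `pow m g` in the
    -- domain. If `pow j g` lies there too, then so does `pow (j % m) g`, and minimality forces j %
    -- m = 0.
    period : Period g
    period with n , gⁿ≈ε ← torsion g
      -- The least exponent is found as the first counterexample to `¬ D`; decidability then removes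
      -- the double negation.
      with Fin.¬∀⟶∃¬-smallest (suc n) (λ i → ¬ D i) (λ i → ¬? (D? i))
             (λ ¬D → ¬D (Fin.fromℕ n) (Dom-resp
                (G.trans (G.sym gⁿ≈ε)
                  (G.reflexive (≡.cong (λ m → pow (suc m) g) (≡.sym (Fin.toℕ-fromℕ n)))))
                Dom-ε))
      where
      D : ∀ {m} → Fin m → Set ℓ
      D i = Dom (pow (suc (toℕ i)) g)
      D? : ∀ {m} (i : Fin m) → Dec (D i)
      D? i = Dom? _
    ... | i , ¬¬Di , smaller = record
      { n-1     = toℕ i
      ; isDom   = Di
      ; divides = λ j Dj → j / m , (begin
          j                        ≡⟨ m≡m%n+[m/n]*n j m ⟩
          j % m ℕ.+ (j / m) ℕ.* m  ≡⟨ ≡.cong (ℕ._+ (j / m) ℕ.* m)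
                                        (small (j % m) (m%n<n j m) (remainder j Dj)) ⟩
          (j / m) ℕ.* m            ∎)
      }
      where
      open ≡.≡-Reasoning
      m = suc (toℕ i)
      Di : Dom (pow m g)
      Di = decidable-stable (Dom? _) ¬¬Di
      remainder : ∀ j → Dom (pow j g) → Dom (pow (j % m) g)
      remainder j Dj = Dom-cancel
        (Dom-resp (G.trans (G.reflexive (≡.cong (λ l → pow l g) (m≡m%n+[m/n]*n j m)))
                    (G.trans (G.pow-+ g (j % m) _) (G.∙-congˡ (G.sym (G.pow-* g (j / m) m))))) Dj)
        (Dom-pow Di (j / m))
      small : ∀ r → r ℕ.< m → Dom (pow r g) → r ≡ 0
      small zero    _   _  = refl
      small (suc r) r<m Dr = contradiction
        (≡.subst (λ l → Dom (pow (suc l) g))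
          (≡.sym (≡.trans (Fin.toℕ-inject (fromℕ< (ℕ.s<s⁻¹ r<m))) (Fin.toℕ-fromℕ< (ℕ.s<s⁻¹ r<m)))) Dr)
        (smaller (fromℕ< (ℕ.s<s⁻¹ r<m)))

  infix 4 _⊑_
  _⊑_ : PartialCharacter → PartialCharacter → Set (c ⊔ ℓ ⊔ ℓ₁)
  χ ⊑ ψ = ∀ {x} (p : χ.Dom x) → ∃[ r ] ψ.val {x} r 𝕂.≈ χ.val p
    where
    module χ = PartialCharacter χ
    module ψ = PartialCharacter ψ

  ⊑-trans : ∀ {χ ψ φ} → χ ⊑ ψ → ψ ⊑ φ → χ ⊑ φ
  ⊑-trans χ⊑ψ ψ⊑φ p =
    let r , e = χ⊑ψ p ; s , e′ = ψ⊑φ r in s , 𝕂.trans e′ e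

  -- The consistency condition on a value w⁻¹ at g: its n-th power must be the value that χ already
  -- has at `pow n g`, for n the period. Working with w instead of w⁻¹ keeps inverses out of the
  -- formula for the extension.
  InverseRoot : ∀ χ {g} → PartialCharacter.Period χ g → 𝕂.Carrier → Set ℓ₁
  InverseRoot χ P w = val isDom * w ^ suc n-1 𝕂.≈ 1#
    where
    open PartialCharacter χ
    open Period P

  -- The extension of χ to the subgroup generated by Dom χ and g that takes
  -- the value w⁻¹ at g.
  module Extension (χ : PartialCharacter) (g : G.Carrier)
    (P : PartialCharacter.Period χ g) (w : 𝕂.Carrier) (wⁿ≈ : InverseRoot χ P w) where

    open PartialCharacter χ
    open Period P

    private
      n : ℕ
      n = suc n-1

    -- As g has finite order modulo `Dom`, natural exponents suffice to describe the generated
    -- subgroup. The exponent i is not unique; `val′-cong` shows that the value does not depend on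
    -- it.
    Dom′ : G.Carrier → Set ℓ
    Dom′ x = ∃[ i ] Dom (x ∙ pow i g)

    val′ : ∀ {x} → Dom′ x → 𝕂.Carrier
    val′ (i , p) = val p * w ^ i

    -- This compatibility is what makes the extension well defined: `divides` writes j as a multiple
    -- of the period, and the claim is then a power of `wⁿ≈`.
    val-pow-g : ∀ j (p : Dom (pow j g)) → val p * w ^ j 𝕂.≈ 1#
    val-pow-g j p with d , refl ← divides j p = begin
      val p * w ^ (d ℕ.* n)
        ≈⟨ 𝕂.*-cong (𝕂.trans (val-cong (G.sym (G.pow-* g d n)) p (Dom-pow isDom d))
                       (val-pow isDom d _))
             (𝕂.trans (𝕂.reflexive (≡.cong (w ^_) (ℕ.*-comm d n))) (𝕂.sym (𝕂.^-assocʳ w n d))) ⟩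
      val isDom ^ d * (w ^ n) ^ d ≈⟨ 𝕂.^-distrib-* _ _ d ⟨
      (val isDom * w ^ n) ^ d     ≈⟨ 𝕂.^-congˡ d wⁿ≈ ⟩
      1# ^ d                      ≈⟨ ^-zeroˡ K d ⟩
      1#                          ∎
      where open 𝕂-Reasoning

    -- The two elements of `Dom` differ by `pow (j ∸ i) g`, which therefore lies in `Dom` as well,
    -- and by `val-pow-g` its value is cancelled by the extra factor w^(j - i).
    val′-cong-≤ : ∀ {x y i j} → i ℕ.≤ j → x ≈ y →
      (p : Dom (x ∙ pow i g)) (r : Dom (y ∙ pow j g)) →
      val p * w ^ i 𝕂.≈ val r * w ^ j
    val′-cong-≤ {x} {y} {i} {j} i≤j x≈y p r = begin
      val p * w ^ i                          ≈⟨ 𝕂.*-identityˡ _ ⟨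
      1# * (val p * w ^ i)                   ≈⟨ 𝕂.*-congʳ (val-pow-g e De) ⟨
      val De * w ^ e * (val p * w ^ i)
        ≈⟨ 𝕂.interchange _ _ _ _ ⟩
      val De * val p * (w ^ e * w ^ i)
        ≈⟨ 𝕂.*-cong (𝕂.sym (val-∙ De p (Dom-∙ De p))) (𝕂.sym (𝕂.^-homo-* w e i)) ⟩
      val (Dom-∙ De p) * w ^ (e ℕ.+ i)
        ≈⟨ 𝕂.*-cong (val-cong (G.sym split) _ r) (𝕂.reflexive (≡.cong (w ^_) e+i≡j)) ⟩
      val r * w ^ j ∎
      where
      open 𝕂-Reasoning
      e = j ∸ i
      e+i≡j : e ℕ.+ i ≡ j
      e+i≡j = ℕ.m∸n+n≡m i≤j
      split : y ∙ pow j g ≈ pow e g ∙ (x ∙ pow i g)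
      split = G.trans (G.∙-cong (G.sym x≈y)
          (G.trans (G.reflexive (≡.cong (λ l → pow l g) (≡.sym e+i≡j))) (G.pow-+ g e i)))
        (G.x∙yz≈y∙xz x (pow e g) (pow i g))
      De : Dom (pow e g)
      De = Dom-cancel (Dom-resp split r) p

    val′-cong : ∀ {x y} → x ≈ y → (p : Dom′ x) (r : Dom′ y) → val′ p 𝕂.≈ val′ r
    val′-cong x≈y (i , p) (j , r) with ℕ.≤-total i j
    ... | inj₁ i≤j = val′-cong-≤ i≤j x≈y p r
    ... | inj₂ j≤i = 𝕂.sym (val′-cong-≤ j≤i (G.sym x≈y) r p)

    pow-n* : ∀ d → Dom (pow (d ℕ.* n) g)
    pow-n* d = Dom-resp (G.pow-* g d n) (Dom-pow isDom d)

    Dom′-∙ : ∀ {x y} → Dom′ x → Dom′ y → Dom′ (x ∙ y)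
    Dom′-∙ {x} {y} (i , p) (j , r) = i ℕ.+ j , Dom-resp (G.trans
      (G.interchange x (pow i g) y (pow j g))
      (G.∙-congˡ (G.sym (G.pow-+ g i j)))) (Dom-∙ p r)

    extension : PartialCharacter
    extension = record
      { Dom        = Dom′
      -- Exponents can be reduced modulo n, so n tests decide membership.
      ; Dom?       = λ x → map′ (λ (i , p) → toℕ i , p) (reduce x)
                       (Fin.any? (λ (i : Fin n) → Dom? (x ∙ pow (toℕ i) g)))
      ; Dom-resp   = λ x≈y (i , p) → i , Dom-resp (G.∙-congʳ x≈y) p
      ; Dom-ε      = 0 , Dom-resp (G.sym (G.identityʳ G.ε)) Dom-ε
      ; Dom-∙      = Dom′-∙
      -- The exponent (n-1)j serves as -j modulo n. Multiplying x y g^i by g^(nj), which lies in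
      -- `Dom`, gives the product of x g^(i+(n-1)j) and y g^j, and the second factor cancels.
      ; Dom-cancel = λ {x} {y} (i , p) (j , r) → i ℕ.+ n-1 ℕ.* j ,
          Dom-cancel (Dom-resp (cancel x y i j) (Dom-∙ p (pow-n* j))) r
      ; val        = val′
      ; val-cong   = val′-cong
      ; val-ε      = λ p → 𝕂.trans
          (val′-cong G.refl p (0 , Dom-resp (G.sym (G.identityʳ G.ε)) Dom-ε))
          (𝕂.trans (𝕂.*-identityʳ _)
            (𝕂.trans (val-cong (G.identityʳ G.ε) _ Dom-ε) (val-ε Dom-ε)))
      ; val-∙      = λ { p@(i , p′) r@(j , r′) s → 𝕂.trans
          (val′-cong G.refl s (Dom′-∙ p r))
          (𝕂.trans (𝕂.*-cong
              (𝕂.trans (val-cong (G.trans (G.∙-congˡ (G.pow-+ g i j)) (G.interchange _ _ (pow i g) (pow j g)))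
                _ (Dom-∙ p′ r′)) (val-∙ p′ r′ _))
              (𝕂.^-homo-* w i j))
            (𝕂.interchange _ _ _ _)) }
      }
      where
      reduce : ∀ x → Dom′ x → ∃[ i ] Dom (x ∙ pow (toℕ {n} i) g)
      reduce x (i , p) = fromℕ< (m%n<n i n) ,
        Dom-resp (G.∙-congˡ (G.reflexive
            (≡.cong (λ l → pow l g) (≡.sym (Fin.toℕ-fromℕ< (m%n<n i n))))))
          (Dom-cancel (Dom-resp (G.trans (G.∙-congˡ (G.trans
              (G.reflexive (≡.cong (λ l → pow l g) (m≡m%n+[m/n]*n i n)))
              (G.pow-+ g (i % n) _))) (G.sym (G.assoc x _ _))) p)
            (pow-n* (i / n)))
      cancel : ∀ x y i j → (x ∙ y) ∙ pow i g ∙ pow (j ℕ.* n) g ≈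
               x ∙ pow (i ℕ.+ n-1 ℕ.* j) g ∙ (y ∙ pow j g)
      cancel x y i j = begin
        (x ∙ y) ∙ pow i g ∙ pow (j ℕ.* n) g
          ≡⟨ ≡.cong (λ l → (x ∙ y) ∙ pow i g ∙ pow l g) (ℕ.*-comm j n) ⟩
        (x ∙ y) ∙ pow i g ∙ pow (j ℕ.+ n-1 ℕ.* j) g
          ≈⟨ G.∙-congˡ (G.pow-+ g j (n-1 ℕ.* j)) ⟩
        (x ∙ y) ∙ pow i g ∙ (pow j g ∙ pow (n-1 ℕ.* j) g)
          ≈⟨ G.∙-congˡ (G.comm (pow j g) _) ⟩
        (x ∙ y) ∙ pow i g ∙ (pow (n-1 ℕ.* j) g ∙ pow j g)
          ≈⟨ G.assoc _ (pow (n-1 ℕ.* j) g) (pow j g) ⟨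
        (x ∙ y) ∙ pow i g ∙ pow (n-1 ℕ.* j) g ∙ pow j g
          ≈⟨ G.∙-congʳ (G.assoc (x ∙ y) (pow i g) _) ⟩
        (x ∙ y) ∙ (pow i g ∙ pow (n-1 ℕ.* j) g) ∙ pow j g
          ≈⟨ G.∙-congʳ (G.xy∙z≈xz∙y x y _) ⟩
        x ∙ (pow i g ∙ pow (n-1 ℕ.* j) g) ∙ y ∙ pow j g
          ≈⟨ G.assoc _ y (pow j g) ⟩
        x ∙ (pow i g ∙ pow (n-1 ℕ.* j) g) ∙ (y ∙ pow j g)
          ≈⟨ G.∙-congʳ (G.∙-congˡ (G.pow-+ g i (n-1 ℕ.* j))) ⟨
        x ∙ pow (i ℕ.+ n-1 ℕ.* j) g ∙ (y ∙ pow j g) ∎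
        where open G-Reasoning

    ⊑-extension : χ ⊑ extension
    ⊑-extension {x} p = (0 , Dom-resp (G.sym (G.identityʳ x)) p) ,
      𝕂.trans (𝕂.*-identityʳ _) (val-cong (G.identityʳ x) _ p)

    -- `pow (suc n-1) g` unfolds to `g ∙ pow n-1 g`, so the exponent n-1 works and `isDom` is the
    -- proof.
    generator∈Dom : Dom′ g
    generator∈Dom = n-1 , isDom

    val-generator : val′ generator∈Dom * w 𝕂.≈ 1#
    val-generator = 𝕂.trans
      (𝕂.trans (𝕂.*-assoc _ _ w) (𝕂.*-congˡ (𝕂.*-comm _ w))) wⁿ≈

  open PartialCharacter using (Dom; val)

  extend : ∀ χ g → ∃[ ψ ] χ ⊑ ψ × Dom ψ g
  extend χ g = extension , ⊑-extension , generator∈Dom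
    where
    open PartialCharacter χ using (module Period; Dom-⁻¹; val-inverseˡ)
    P = period χ g
    open Period P
    -- χ takes inverse values at `pow n g` and at its inverse, for n = suc n-1, so an n-th root of
    -- the latter value satisfies `InverseRoot`.
    root = nthRoot K n-1 (val χ (Dom-⁻¹ isDom))
    open Extension χ g P (proj₁ root)
      (𝕂.trans (𝕂.*-congˡ (proj₂ root)) (𝕂.trans (𝕂.*-comm _ _) (val-inverseˡ isDom _)))

  extendAll : ∀ {m} χ (gs : Fin m → G.Carrier) → ∃[ ψ ] χ ⊑ ψ × (∀ i → Dom ψ (gs i))
  extendAll {zero}  χ gs = χ , (λ p → p , 𝕂.refl) , λ ()
  extendAll {suc m} χ gs =
    let ψ , χ⊑ψ , gs₀∈ψ = extend χ (gs zero)
        φ , ψ⊑φ , gs₊∈φ = extendAll ψ (gs ∘ suc)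
    in φ , ⊑-trans {χ} {ψ} {φ} χ⊑ψ ψ⊑φ , λ { zero → proj₁ (ψ⊑φ gs₀∈ψ) ; (suc i) → gs₊∈φ i }

  trivial : PartialCharacter
  trivial = record
    { Dom        = λ x → x ≈ G.ε
    ; Dom?       = _≟ G.ε
    ; Dom-resp   = λ x≈y → G.trans (G.sym x≈y)
    ; Dom-ε      = G.refl
    ; Dom-∙      = λ p r → G.trans (G.∙-cong p r) (G.identityˡ G.ε)
    ; Dom-cancel = λ p r → G.trans (G.sym (G.identityʳ _)) (G.trans (G.∙-congˡ (G.sym r)) p)
    ; val        = λ _ → 1#
    ; val-cong   = λ _ _ _ → 𝕂.refl
    ; val-ε      = λ _ → 𝕂.refl
    ; val-∙      = λ _ _ _ → 𝕂.sym (𝕂.*-identityˡ 1#)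
    }

  toHomomorphism : (χ : PartialCharacter) → (∀ x → Dom χ x) →
    GroupHomomorphism G.rawGroup (AbelianGroup.rawGroup (unitGroup 𝕂.commutativeRing))
  toHomomorphism χ total = record
    { ⟦_⟧ = λ x → val χ (total x) , val χ (total (x G.⁻¹)) ,
                  val-inverseˡ _ _ , 𝕂.trans (𝕂.*-comm _ _) (val-inverseˡ _ _)
    ; isGroupHomomorphism = record
      { isMonoidHomomorphism = record
        { isMagmaHomomorphism = record
          { isRelHomomorphism = record { cong = λ x≈y → val-cong x≈y _ _ }
          ; homo = λ _ _ → val-∙ _ _ _
          }
        ; ε-homo = val-ε _
        }
      ; ⁻¹-homo = λ _ → 𝕂.refl
      }
    }
    where open PartialCharacter χ using (val-cong; val-∙; val-ε; val-inverseˡ)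

  -- Adjoining the finitely many listed elements one after another exhausts the group.
  extendTotally : ∀ χ → ∃[ ψ ] χ ⊑ ψ × (∀ x → Dom ψ x)
  extendTotally χ =
    let ψ , χ⊑ψ , elements∈ψ = extendAll χ element
    in ψ , χ⊑ψ , λ x →
      PartialCharacter.Dom-resp ψ {element (index x)} {x} (element-index x) (elements∈ψ (index x))

  ⊑-val-≉1 : ∀ {χ ψ} → χ ⊑ ψ → ∀ {x w} (p : Dom χ x) → val χ p * w 𝕂.≈ 1# → ¬ w 𝕂.≈ 1# →
    (r : Dom ψ x) → ¬ val ψ r 𝕂.≈ 1#
  ⊑-val-≉1 {χ} {ψ} χ⊑ψ {x} {w} p val*w≈1 w≉1 r val≈1 = w≉1 (begin
    w                          ≈⟨ 𝕂.*-identityˡ w ⟨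
    1# * w                     ≈⟨ 𝕂.*-congʳ val≈1 ⟨
    val ψ r * w                ≈⟨ 𝕂.*-congʳ (PartialCharacter.val-cong ψ G.refl r (proj₁ (χ⊑ψ p))) ⟩
    val ψ (proj₁ (χ⊑ψ p)) * w  ≈⟨ 𝕂.*-congʳ (proj₂ (χ⊑ψ p)) ⟩
    val χ p * w                ≈⟨ val*w≈1 ⟩
    1#                         ∎)
    where open 𝕂-Reasoning

  -- Over the trivial subgroup the period of g is its order. Order 1 would make g the identity; for
  -- order at least 2 a nontrivial root of unity w of that order exists, and the extension takes the
  -- value w⁻¹ at g.
  nontrivialAt : ∀ g → ¬ g ≈ G.ε → (P : PartialCharacter.Period trivial g) →
    ∃[ χ ] ∃[ w ] ∃[ p ] val χ {g} p * w 𝕂.≈ 1# × ¬ w 𝕂.≈ 1#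
  nontrivialAt g g≉ε record { n-1 = zero ; isDom = p } =
    contradiction (G.trans (G.sym (G.identityʳ g)) p) g≉ε
  nontrivialAt g g≉ε P@record { n-1 = suc n } =
    let w , wⁿ≈1 , w≉1 = nontrivialRootOfUnity K n
        open Extension trivial g P w (𝕂.trans (𝕂.*-identityˡ _) wⁿ≈1)
    in extension , w , generator∈Dom , val-generator , w≉1

  separate : ∀ g → ¬ g ≈ G.ε →
    ∃[ χ ] ¬ proj₁ (GroupHomomorphism.⟦_⟧ χ g) 𝕂.≈ 1#
  separate g g≉ε =
    let χ , w , p , val*w≈1 , w≉1 = nontrivialAt g g≉ε (period trivial g)
        ψ , χ⊑ψ , total = extendTotally χ
    in toHomomorphism ψ total , ⊑-val-≉1 {χ} {ψ} χ⊑ψ {g} p val*w≈1 w≉1 (total g)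

-- Sums over an enumerated setoid

module EnumeratedSum {a r s t n} (R : CommutativeRing a r) (S : Setoid s t)
  (enumeration : Inverse (≡.setoid (Fin n)) S) where

  open CommutativeRing R hiding (refl; sym; trans)
  open SetoidReasoning setoid
  private
    module R = CommutativeRing R
    module S = Setoid S
    module Σ = CommutativeMonoidSum +-commutativeMonoid
  open Inverse enumeration using (to; from; from-cong; strictlyInverseˡ; strictlyInverseʳ)

  -- For the enumerations of field elements and of characters this unfolds to `∑𝔽` and `∑χ`, so the
  -- laws below apply to both as they stand.
  ∑ : (S.Carrier → Carrier) → Carrier
  ∑ f = Σ.sum (f ∘ to)

  ∑-cong : ∀ {f g : S.Carrier → Carrier} → (∀ x → f x ≈ g x) → ∑ f ≈ ∑ g
  ∑-cong f≈g = Σ.sum-cong-≋ (f≈g ∘ to)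

  ∑-+ : ∀ f g → ∑ (λ x → f x + g x) ≈ ∑ f + ∑ g
  ∑-+ f g = Σ.∑-distrib-+ (f ∘ to) (g ∘ to)

  *-∑ : ∀ c f → c * ∑ f ≈ ∑ (λ x → c * f x)
  *-∑ c f = SemiringSum.*-distribˡ-sum semiring c (f ∘ to)

  ∑-* : ∀ c f → ∑ f * c ≈ ∑ (λ x → f x * c)
  ∑-* c f = SemiringSum.*-distribʳ-sum semiring c (f ∘ to)

  -- Conjugated with the enumeration, φ becomes a permutation of `Fin n` whose inverse comes from ψ.
  ∑-reindex : ∀ (f : S.Carrier → Carrier) → (∀ {x y} → x S.≈ y → f x ≈ f y) →
    (φ ψ : S.Carrier → S.Carrier) →
    (∀ {x y} → x S.≈ y → φ x S.≈ φ y) → (∀ {x y} → x S.≈ y → ψ x S.≈ ψ y) →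
    (∀ x → φ (ψ x) S.≈ x) → (∀ x → ψ (φ x) S.≈ x) →
    ∑ (f ∘ φ) ≈ ∑ f
  ∑-reindex f f-cong φ ψ φ-cong ψ-cong φψ ψφ = R.trans
    (Σ.sum-cong-≋ (λ i → f-cong (S.sym (strictlyInverseˡ (φ (to i))))))
    (R.sym (Σ.sum-permute (f ∘ to) (permutation (from ∘ φ ∘ to) (from ∘ ψ ∘ to)
      (conjugate φ ψ φ-cong φψ) (conjugate ψ φ ψ-cong ψφ))))
    where
    conjugate : ∀ φ ψ → (∀ {x y} → x S.≈ y → φ x S.≈ φ y) → (∀ x → φ (ψ x) S.≈ x) →
      ∀ i → from (φ (to (from (ψ (to i))))) ≡ i
    conjugate φ ψ φ-cong φψ i = ≡.trans
      (from-cong (S.trans (φ-cong (strictlyInverseˡ _)) (φψ (to i)))) (strictlyInverseʳ i)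

  infix 4 _≟_
  -- Comparing positions in the enumeration decides equality. For characters this works although
  -- equality of their values in K need not be decidable.
  _≟_ : Decidable S._≈_
  _≟_ = via-injection (Inverse⇒Injection (↔-sym enumeration)) Fin._≟_

  δ : S.Carrier → S.Carrier → Carrier
  δ x y with x ≟ y
  ... | yes _ = 1#
  ... | no  _ = 0#

  δ-≈ : ∀ {x y} → x S.≈ y → δ x y ≈ 1#
  δ-≈ {x} {y} x≈y with x ≟ y
  ... | yes _   = R.refl
  ... | no  x≉y = contradiction x≈y x≉y

  δ-≉ : ∀ {x y} → ¬ x S.≈ y → δ x y ≈ 0#
  δ-≉ {x} {y} x≉y with x ≟ y
  ... | yes x≈y = contradiction x≈y x≉y
  ... | no  _   = R.refl

  sum-singleton : ∀ {m} (v : Vector Carrier m) j → (∀ i → i ≢ j → v i ≈ 0#) → Σ.sum v ≈ v j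
  sum-singleton {suc m} v j v≈0 = begin
    Σ.sum v                      ≈⟨ Σ.sum-remove v ⟩
    v j + Σ.sum (removeAt v j)
      ≈⟨ +-congˡ (Σ.sum-cong-≋ (λ i → v≈0 (punchIn j i) (Fin.punchInᵢ≢i j i))) ⟩
    v j + Σ.sum (replicate m 0#) ≈⟨ +-congˡ (Σ.sum-replicate-zero m) ⟩
    v j + 0#                     ≈⟨ +-identityʳ (v j) ⟩
    v j                          ∎

  ∑-sift : ∀ (f : S.Carrier → Carrier) y → (∀ {x} → x S.≈ y → f x ≈ f y) → ∑ (λ x → f x * δ x y) ≈ f y
  ∑-sift f y f-cong = begin
    ∑ (λ x → f x * δ x y)
      ≈⟨ sum-singleton _ (from y) (λ i i≢ → R.trans (*-congˡ (δ-≉ (λ toi≈y →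
           i≢ (≡.trans (≡.sym (strictlyInverseʳ i)) (from-cong toi≈y))))) (zeroʳ _)) ⟩
    f (to (from y)) * δ (to (from y)) y
      ≈⟨ *-cong (f-cong (strictlyInverseˡ y)) (δ-≈ (strictlyInverseˡ y)) ⟩
    f y * 1#
      ≈⟨ *-identityʳ (f y) ⟩
    f y ∎

-- Values of characters extended by zero

module CharacterValues {c ℓ q k ℓ₁ ℓ₂}
  (𝔽 : FiniteField c ℓ q) (K : AlgClosedCharZeroField k ℓ₁ ℓ₂) where

  open Characters 𝔽 K
  module F where
    open FiniteField 𝔽 public
    open RingProperties ring public using
      ( -1*x≈-x; -‿distribˡ-*; -‿distribʳ-*; -‿involutive
      ; xyx⁻¹≈y; ⁻¹-anti-homo-//; x∙y⁻¹≈ε⇒x≈y)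
  module 𝕂 where
    open AlgClosedCharZeroField K public
    open RingProperties (CommutativeRing.ring commutativeRing) public
      using (-0#≈0#; +-cancelʳ)
    +-commutativeMonoid = CommutativeRing.+-commutativeMonoid commutativeRing
    *-commutativeMonoid = CommutativeRing.*-commutativeMonoid commutativeRing
  module F× = AbelianGroup (unitGroup F.commutativeRing)
  open 𝕂 using (_*_; _+_; 0#; 1#; _≈_; *-cong; *-congˡ; *-congʳ)
  open GroupHomomorphism using (⟦_⟧; ⟦⟧-cong; homo; ε-homo; ⁻¹-homo)
  open SetoidReasoning 𝕂.setoid

  unit : ∀ x → ¬ x F.≈ F.0# → F×.Carrier
  unit x x≉0 = x , F.≉0⇒invertible x x≉0

  *≈1⇒≉0 : ∀ {x y} → x F.* y F.≈ F.1# → ¬ x F.≈ F.0#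
  *≈1⇒≉0 xy≈1 x≈0 =
    F.0≉1 (F.trans (F.sym (F.zeroˡ _)) (F.trans (F.*-congʳ (F.sym x≈0)) xy≈1))

  unit≉0 : ∀ (u : F×.Carrier) → ¬ proj₁ u F.≈ F.0#
  unit≉0 (_ , _ , _ , xx′≈1) = *≈1⇒≉0 xx′≈1

  ⟨⟩-zero : ∀ χ {x} → x F.≈ F.0# → χ ⟨ x ⟩ ≈ 0#
  ⟨⟩-zero χ {x} x≈0 with x F.≟ F.0#
  ... | yes _  = 𝕂.refl
  ... | no x≉0 = contradiction x≈0 x≉0

  -- Equality of units compares first components only, so the inverse that the definition of
  -- `χ ⟨ x ⟩` picks may be replaced by any other.
  ⟨⟩-unit : ∀ χ (u : F×.Carrier) {x} → x F.≈ proj₁ u → χ ⟨ x ⟩ ≈ proj₁ (⟦ χ ⟧ u)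
  ⟨⟩-unit χ u {x} x≈u with x F.≟ F.0#
  ... | yes x≈0 = contradiction (F.trans (F.sym x≈u) x≈0) (unit≉0 u)
  ... | no  x≉0 = ⟦⟧-cong χ {unit x x≉0} {u} x≈u

  ⟨⟩-cong : ∀ χ {x y} → x F.≈ y → χ ⟨ x ⟩ ≈ χ ⟨ y ⟩
  ⟨⟩-cong χ {x} {y} x≈y with toSum (y F.≟ F.0#)
  ... | inj₁ y≈0 = 𝕂.trans (⟨⟩-zero χ (F.trans x≈y y≈0)) (𝕂.sym (⟨⟩-zero χ y≈0))
  ... | inj₂ y≉0 =
    𝕂.trans (⟨⟩-unit χ (unit y y≉0) x≈y) (𝕂.sym (⟨⟩-unit χ (unit y y≉0) F.refl))

  ⟨⟩-ext : ∀ {χ ψ} → Setoid._≈_ characterSetoid χ ψ → ∀ x → χ ⟨ x ⟩ ≈ ψ ⟨ x ⟩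
  ⟨⟩-ext {χ} {ψ} χ≈ψ x with toSum (x F.≟ F.0#)
  ... | inj₁ x≈0 = 𝕂.trans (⟨⟩-zero χ x≈0) (𝕂.sym (⟨⟩-zero ψ x≈0))
  ... | inj₂ x≉0 = 𝕂.trans (⟨⟩-unit χ u F.refl)
    (𝕂.trans (χ≈ψ u) (𝕂.sym (⟨⟩-unit ψ u F.refl)))
    where u = unit x x≉0

  ⟨⟩-* : ∀ χ x y → χ ⟨ x F.* y ⟩ ≈ χ ⟨ x ⟩ * χ ⟨ y ⟩
  ⟨⟩-* χ x y with toSum (x F.≟ F.0#) | toSum (y F.≟ F.0#)
  ... | inj₁ x≈0 | _ = 𝕂.trans (⟨⟩-zero χ (F.trans (F.*-congʳ x≈0) (F.zeroˡ y)))
    (𝕂.sym (𝕂.trans (*-congʳ (⟨⟩-zero χ x≈0)) (𝕂.zeroˡ _)))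
  ... | inj₂ _ | inj₁ y≈0 = 𝕂.trans (⟨⟩-zero χ (F.trans (F.*-congˡ y≈0) (F.zeroʳ x)))
    (𝕂.sym (𝕂.trans (*-congˡ (⟨⟩-zero χ y≈0)) (𝕂.zeroʳ _)))
  ... | inj₂ x≉0 | inj₂ y≉0 = 𝕂.trans (⟨⟩-unit χ (u F×.∙ v) F.refl)
    (𝕂.trans (homo χ u v) (𝕂.sym (*-cong (⟨⟩-unit χ u F.refl) (⟨⟩-unit χ v F.refl))))
    where
    u = unit x x≉0
    v = unit y y≉0

  ⟨1⟩ : ∀ χ {x} → x F.≈ F.1# → χ ⟨ x ⟩ ≈ 1#
  ⟨1⟩ χ x≈1 = 𝕂.trans (⟨⟩-unit χ F×.ε x≈1) (ε-homo χ)

  ε-⟨⟩ : ∀ {x} → ¬ x F.≈ F.0# → ε ⟨ x ⟩ ≈ 1#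
  ε-⟨⟩ {x} x≉0 = ⟨⟩-unit ε (unit x x≉0) F.refl

  ·-⟨⟩ : ∀ χ ψ x → (χ · ψ) ⟨ x ⟩ ≈ χ ⟨ x ⟩ * ψ ⟨ x ⟩
  ·-⟨⟩ χ ψ x with toSum (x F.≟ F.0#)
  ... | inj₁ x≈0 = 𝕂.trans (⟨⟩-zero (χ · ψ) x≈0)
    (𝕂.sym (𝕂.trans (*-congʳ (⟨⟩-zero χ x≈0)) (𝕂.zeroˡ _)))
  ... | inj₂ x≉0 = 𝕂.trans (⟨⟩-unit (χ · ψ) u F.refl)
    (𝕂.sym (*-cong (⟨⟩-unit χ u F.refl) (⟨⟩-unit ψ u F.refl)))
    where u = unit x x≉0

  ε-absorb : ∀ χ x → ε ⟨ x ⟩ * χ ⟨ x ⟩ ≈ χ ⟨ x ⟩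
  ε-absorb χ x with toSum (x F.≟ F.0#)
  ... | inj₁ x≈0 = 𝕂.trans (*-congˡ (⟨⟩-zero χ x≈0))
    (𝕂.trans (𝕂.zeroʳ _) (𝕂.sym (⟨⟩-zero χ x≈0)))
  ... | inj₂ x≉0 = 𝕂.trans (*-congʳ (ε-⟨⟩ x≉0)) (𝕂.*-identityˡ _)

  ⟨⟩-inverse : ∀ χ {x y} → x F.* y F.≈ F.1# → χ ⟨ x ⟩ * χ ⟨ y ⟩ ≈ 1#
  ⟨⟩-inverse χ {x} {y} xy≈1 = 𝕂.trans (𝕂.sym (⟨⟩-* χ x y)) (⟨1⟩ χ xy≈1)

  ⁻¹-⟨⟩ : ∀ χ {x y} → x F.* y F.≈ F.1# → (χ ⁻¹) ⟨ x ⟩ ≈ χ ⟨ y ⟩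
  ⁻¹-⟨⟩ χ {x} {y} xy≈1 = 𝕂.trans (⟨⟩-unit (χ ⁻¹) u F.refl)
    (𝕂.sym (𝕂.trans (⟨⟩-unit χ (u F×.⁻¹) F.refl) (⁻¹-homo χ u)))
    where
    u : F×.Carrier
    u = x , y , F.trans (F.*-comm y x) xy≈1 , xy≈1

  ⁻¹·-⟨⟩ : ∀ χ x → (χ ⁻¹) ⟨ x ⟩ * χ ⟨ x ⟩ ≈ ε ⟨ x ⟩
  ⁻¹·-⟨⟩ χ x with toSum (x F.≟ F.0#)
  ... | inj₁ x≈0 = 𝕂.trans (*-congˡ (⟨⟩-zero χ x≈0))
    (𝕂.trans (𝕂.zeroʳ _) (𝕂.sym (⟨⟩-zero ε x≈0)))
  ... | inj₂ x≉0 with x′ , x′x≈1 , xx′≈1 ← F.≉0⇒invertible x x≉0 =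
    𝕂.trans (*-congʳ (⁻¹-⟨⟩ χ xx′≈1)) (𝕂.trans (⟨⟩-inverse χ x′x≈1) (𝕂.sym (ε-⟨⟩ x≉0)))

  -1*-1≈1 : -1F F.* -1F F.≈ F.1#
  -1*-1≈1 = F.trans (F.-1*x≈-x -1F) (F.-‿involutive F.1#)

  ⟨-1⟩²≈1 : ∀ χ → χ ⟨ -1F ⟩ * χ ⟨ -1F ⟩ ≈ 1#
  ⟨-1⟩²≈1 χ = ⟨⟩-inverse χ -1*-1≈1

  ⟨-⟩ : ∀ χ x → χ ⟨ F.- x ⟩ ≈ χ ⟨ -1F ⟩ * χ ⟨ x ⟩
  ⟨-⟩ χ x = 𝕂.trans (⟨⟩-cong χ (F.sym (F.-1*x≈-x x))) (⟨⟩-* χ -1F x)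

-- Orthogonality of the characters of the finite field

module AppellExpansion {c ℓ q k ℓ₁ ℓ₂}
  (𝔽 : FiniteField c ℓ q) (K : AlgClosedCharZeroField k ℓ₁ ℓ₂)
  (E : Characters.CharacterEnumeration 𝔽 K) {{q-1≢0 : NonZero (q ∸ 1)}} where

  open Characters 𝔽 K
  open CharacterValues 𝔽 K
  open CharacterEnumeration E using (size; characters)
  open 𝕂 using (_*_; _+_; 0#; 1#; _≈_; *-cong; *-congˡ; *-congʳ)
  open GroupHomomorphism using (⟦_⟧)
  open SetoidReasoning 𝕂.setoid
  open CommutativeMonoidSolver 𝕂.*-commutativeMonoid using (solve; _⊕_; _⊜_)

  module ∑F = EnumeratedSum 𝕂.commutativeRing F.setoid F.elements
  module ∑X = EnumeratedSum 𝕂.commutativeRing characterSetoid characters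
  open ∑F using () renaming (δ to δF)
  open ∑X using () renaming (∑ to ∑X)

  private
    module X = Setoid characterSetoid
    index = Inverse.from F.elements
    el = Inverse.to F.elements
    el-index = Inverse.strictlyInverseˡ F.elements

  -- The position of 0 is filled with 1. The resulting repetition is harmless, as
  -- `SeparatingCharacters` asks only that every unit be listed.
  nonzeroElement : Fin q → F×.Carrier
  nonzeroElement i with toSum (el i F.≟ F.0#)
  ... | inj₁ _   = F×.ε
  ... | inj₂ i≉0 = unit (el i) i≉0

  nonzeroElement-index : ∀ u → nonzeroElement (index (proj₁ u)) F×.≈ u
  nonzeroElement-index u with toSum (el (index (proj₁ u)) F.≟ F.0#)
  ... | inj₁ i≈0 = contradiction (F.trans (F.sym (el-index (proj₁ u))) i≈0) (unit≉0 u)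
  ... | inj₂ _   = el-index (proj₁ u)

  open SeparatingCharacters (unitGroup F.commutativeRing) K
    (λ x y → proj₁ x F.≟ proj₁ y) nonzeroElement (λ u → index (proj₁ u))
    nonzeroElement-index
    using (separate)

  separate-⟨⟩ : ∀ {x} → ¬ x F.≈ F.0# → ¬ x F.≈ F.1# → ∃[ χ ] ¬ χ ⟨ x ⟩ ≈ 1#
  separate-⟨⟩ {x} x≉0 x≉1 =
    let χ , χx≉1 = separate (unit x x≉0) x≉1
    in χ , λ χx≈1 → χx≉1 (𝕂.trans (𝕂.sym (⟨⟩-unit χ (unit x x≉0) F.refl)) χx≈1)

  -- Apartness from 0 makes s invertible, so it cancels; `#⇒invertible` inverts the difference of s
  -- and 0 rather than s itself.
  fixed⇒≈1 : ∀ {a s} → s 𝕂.# 0# → a * s ≈ s → a ≈ 1#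
  fixed⇒≈1 {a} {s} s#0 as≈s with t , _ , st≈1 ← 𝕂.#⇒invertible s#0 = begin
    a                       ≈⟨ 𝕂.*-identityʳ a ⟨
    a * 1#                  ≈⟨ *-congˡ st≈1 ⟨
    a * ((s 𝕂.- 0#) * t)    ≈⟨ *-congˡ (*-congʳ s-0≈s) ⟩
    a * (s * t)             ≈⟨ 𝕂.*-assoc a s t ⟨
    a * s * t               ≈⟨ *-congʳ as≈s ⟩
    s * t                   ≈⟨ *-congʳ s-0≈s ⟨
    (s 𝕂.- 0#) * t          ≈⟨ st≈1 ⟩
    1#                      ∎
    where
    s-0≈s : s 𝕂.- 0# ≈ s
    s-0≈s = 𝕂.trans (𝕂.+-congˡ 𝕂.-0#≈0#) (𝕂.+-identityʳ s)

  fixed⇒≈0 : ∀ {a s} → ¬ a ≈ 1# → a * s ≈ s → s ≈ 0#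
  fixed⇒≈0 {a} {s} a≉1 as≈s = proj₁ (𝕂.tight s 0#) (λ s#0 → a≉1 (fixed⇒≈1 s#0 as≈s))

  ·-congˡ : ∀ ψ {χ φ} → χ X.≈ φ → ψ · χ X.≈ ψ · φ
  ·-congˡ ψ χ≈φ u = *-congˡ {proj₁ (⟦ ψ ⟧ u)} (χ≈φ u)

  cancel-* : ∀ a b c → a * b ≈ 1# → a * (b * c) ≈ c
  cancel-* a b c ab≈1 = 𝕂.trans (𝕂.sym (𝕂.*-assoc a b c)) (𝕂.trans (*-congʳ ab≈1) (𝕂.*-identityˡ c))

  ·-cancelˡ : ∀ ψ χ → ψ · (ψ ⁻¹ · χ) X.≈ χ
  ·-cancelˡ ψ χ u with ⟦ ψ ⟧ u
  ... | a , b , _ , ab≈1 = cancel-* a b (proj₁ (⟦ χ ⟧ u)) ab≈1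

  ·-cancelˡ⁻¹ : ∀ ψ χ → ψ ⁻¹ · (ψ · χ) X.≈ χ
  ·-cancelˡ⁻¹ ψ χ u with ⟦ ψ ⟧ u
  ... | a , b , ba≈1 , _ = cancel-* b a (proj₁ (⟦ χ ⟧ u)) ba≈1

  -- Multiplication by ψ only permutes the characters in the sum.
  ∑X-translate : ∀ ψ x → ψ ⟨ x ⟩ * ∑X (λ χ → χ ⟨ x ⟩) ≈ ∑X (λ χ → χ ⟨ x ⟩)
  ∑X-translate ψ x = begin
    ψ ⟨ x ⟩ * ∑X (λ χ → χ ⟨ x ⟩)    ≈⟨ ∑X.*-∑ (ψ ⟨ x ⟩) (λ χ → χ ⟨ x ⟩) ⟩
    ∑X (λ χ → ψ ⟨ x ⟩ * χ ⟨ x ⟩)    ≈⟨ ∑X.∑-cong (λ χ → ·-⟨⟩ ψ χ x) ⟨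
    ∑X (λ χ → (ψ · χ) ⟨ x ⟩)
      ≈⟨ ∑X.∑-reindex (λ χ → χ ⟨ x ⟩) (λ {χ} {φ} χ≈φ → ⟨⟩-ext {χ} {φ} χ≈φ x)
           (ψ ·_) (ψ ⁻¹ ·_) (λ {χ} {φ} → ·-congˡ ψ {χ} {φ}) (λ {χ} {φ} → ·-congˡ (ψ ⁻¹) {χ} {φ})
           (·-cancelˡ ψ) (·-cancelˡ⁻¹ ψ) ⟩
    ∑X (λ χ → χ ⟨ x ⟩)              ∎

  ∑X-zero : ∑X (λ _ → 0#) ≈ 0#
  ∑X-zero = Sum.sum-replicate-zero 𝕂.+-monoid size

  ∑X-⟨⟩-vanishes : ∀ {x} → ¬ x F.≈ F.1# → ∑X (λ χ → χ ⟨ x ⟩) ≈ 0#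
  ∑X-⟨⟩-vanishes {x} x≉1 with toSum (x F.≟ F.0#)
  ... | inj₁ x≈0 = 𝕂.trans (∑X.∑-cong (λ χ → ⟨⟩-zero χ x≈0)) ∑X-zero
  ... | inj₂ x≉0 =
    let ψ , ψx≉1 = separate-⟨⟩ x≉0 x≉1 in fixed⇒≈0 ψx≉1 (∑X-translate ψ x)

  -- `¬ χ X.≈ ε` supplies no unit u at which χ differs from 1, so the argument runs backwards.
  -- Scaling x by u permutes the terms, so the sum is fixed by χ(u); were it apart from 0, χ(u)
  -- would be 1 for every u.
  ∑F-⟨⟩-vanishes : ∀ {χ} → ¬ χ X.≈ ε → ∑𝔽 (λ x → χ ⟨ x ⟩) ≈ 0#
  ∑F-⟨⟩-vanishes {χ} χ≉ε = proj₁ (𝕂.tight _ 0#) (λ s#0 → χ≉ε (λ u →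
    𝕂.trans (𝕂.sym (⟨⟩-unit χ u F.refl)) (fixed⇒≈1 s#0 (invariant u))))
    where
    invariant : ∀ u → χ ⟨ proj₁ u ⟩ * ∑𝔽 (λ x → χ ⟨ x ⟩) ≈ ∑𝔽 (λ x → χ ⟨ x ⟩)
    invariant (u , u′ , u′u≈1 , uu′≈1) = begin
      χ ⟨ u ⟩ * ∑𝔽 (λ x → χ ⟨ x ⟩)   ≈⟨ ∑F.*-∑ (χ ⟨ u ⟩) (λ x → χ ⟨ x ⟩) ⟩
      ∑𝔽 (λ x → χ ⟨ u ⟩ * χ ⟨ x ⟩)   ≈⟨ ∑F.∑-cong (λ x → ⟨⟩-* χ u x) ⟨
      ∑𝔽 (λ x → χ ⟨ u F.* x ⟩)
        ≈⟨ ∑F.∑-reindex (λ x → χ ⟨ x ⟩) (⟨⟩-cong χ) (u F.*_) (u′ F.*_) F.*-congˡ F.*-congˡ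
             (λ _ → cancel uu′≈1) (λ _ → cancel u′u≈1) ⟩
      ∑𝔽 (λ x → χ ⟨ x ⟩)             ∎
      where
      cancel : ∀ {a b c} → a F.* b F.≈ F.1# → a F.* (b F.* c) F.≈ c
      cancel ab≈1 =
        F.trans (F.sym (F.*-assoc _ _ _)) (F.trans (F.*-congʳ ab≈1) (F.*-identityˡ _))

  [q-1] : 𝕂.Carrier
  [q-1] = (q ∸ 1) 𝕂.×ₙ 1#

  1+[q∸1]≡q : suc (q ∸ 1) ≡ q
  1+[q∸1]≡q = lemma q q-1≢0
    where
    lemma : ∀ n → NonZero (n ∸ 1) → suc (n ∸ 1) ≡ n
    lemma (suc n) _ = refl

  -- Adding the indicator of 0 completes ε to the constant 1, whose sum is q.
  ∑F-ε : ∑𝔽 (λ x → ε ⟨ x ⟩) ≈ [q-1]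
  ∑F-ε = 𝕂.+-cancelʳ 1# _ _ (begin
    ∑𝔽 (λ x → ε ⟨ x ⟩) + 1#
      ≈⟨ 𝕂.+-congˡ (∑F.∑-sift (λ _ → 1#) F.0# (λ _ → 𝕂.refl)) ⟨
    ∑𝔽 (λ x → ε ⟨ x ⟩) + ∑𝔽 (λ x → 1# * δF x F.0#)  ≈⟨ ∑F.∑-+ (λ x → ε ⟨ x ⟩) (λ x → 1# * δF x F.0#) ⟨
    ∑𝔽 (λ x → ε ⟨ x ⟩ + 1# * δF x F.0#)             ≈⟨ ∑F.∑-cong complement ⟩
    ∑𝔽 (λ _ → 1#)                   ≈⟨ Sum.sum-replicate 𝕂.+-monoid q ⟩
    q 𝕂.×ₙ 1#                       ≡⟨ ≡.cong (𝕂._×ₙ 1#) 1+[q∸1]≡q ⟨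
    1# + [q-1]                      ≈⟨ 𝕂.+-comm 1# [q-1] ⟩
    [q-1] + 1#                      ∎)
    where
    complement : ∀ x → ε ⟨ x ⟩ + 1# * δF x F.0# ≈ 1#
    complement x with toSum (x F.≟ F.0#)
    ... | inj₁ x≈0 = 𝕂.trans
      (𝕂.+-cong (⟨⟩-zero ε x≈0) (𝕂.trans (𝕂.*-identityˡ _) (∑F.δ-≈ x≈0))) (𝕂.+-identityˡ 1#)
    ... | inj₂ x≉0 = 𝕂.trans
      (𝕂.+-cong (ε-⟨⟩ x≉0) (𝕂.trans (𝕂.*-identityˡ _) (∑F.δ-≉ x≉0))) (𝕂.+-identityʳ 1#)

  -- Evaluating the double sum of χ(x) over χ and x in both orders.
  ∑X-⟨1⟩ : ∑X (λ χ → χ ⟨ F.1# ⟩) ≈ [q-1]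
  ∑X-⟨1⟩ = begin
    s                                        ≈⟨ ∑F.∑-sift (λ _ → s) F.1# (λ _ → 𝕂.refl) ⟨
    ∑𝔽 (λ x → s * δF x F.1#)                 ≈⟨ ∑F.∑-cong column ⟨
    ∑𝔽 (λ x → ∑X (λ χ → χ ⟨ x ⟩))
      ≈⟨ CommutativeMonoidSum.∑-comm 𝕂.+-commutativeMonoid {q} {size} (λ i j → Inverse.to characters j ⟨ el i ⟩) ⟩
    ∑X (λ χ → ∑𝔽 (λ x → χ ⟨ x ⟩))            ≈⟨ ∑X.∑-cong row ⟩
    ∑X (λ χ → [q-1] * ∑X.δ χ ε)              ≈⟨ ∑X.∑-sift (λ _ → [q-1]) ε (λ _ → 𝕂.refl) ⟩
    [q-1]                                    ∎
    where
    s = ∑X (λ χ → χ ⟨ F.1# ⟩)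
    column : ∀ x → ∑X (λ χ → χ ⟨ x ⟩) ≈ s * δF x F.1#
    column x with toSum (x F.≟ F.1#)
    ... | inj₁ x≈1 = 𝕂.trans (∑X.∑-cong (λ χ → ⟨⟩-cong χ x≈1))
      (𝕂.sym (𝕂.trans (*-congˡ (∑F.δ-≈ x≈1)) (𝕂.*-identityʳ s)))
    ... | inj₂ x≉1 = 𝕂.trans (∑X-⟨⟩-vanishes x≉1)
      (𝕂.sym (𝕂.trans (*-congˡ (∑F.δ-≉ x≉1)) (𝕂.zeroʳ s)))
    row : ∀ χ → ∑𝔽 (λ x → χ ⟨ x ⟩) ≈ [q-1] * ∑X.δ χ ε
    row χ with toSum (χ ∑X.≟ ε)
    ... | inj₁ χ≈ε = 𝕂.trans (∑F.∑-cong (⟨⟩-ext {χ} {ε} χ≈ε)) (𝕂.trans ∑F-ε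
      (𝕂.sym (𝕂.trans (*-congˡ (∑X.δ-≈ {χ} {ε} χ≈ε)) (𝕂.*-identityʳ _))))
    ... | inj₂ χ≉ε = 𝕂.trans (∑F-⟨⟩-vanishes {χ} χ≉ε)
      (𝕂.sym (𝕂.trans (*-congˡ (∑X.δ-≉ {χ} {ε} χ≉ε)) (𝕂.zeroʳ _)))

  orthogonality : ∀ x → ∑X (λ χ → χ ⟨ x ⟩) ≈ [q-1] * δF x F.1#
  orthogonality x with toSum (x F.≟ F.1#)
  ... | inj₁ x≈1 = 𝕂.trans (∑X.∑-cong (λ χ → ⟨⟩-cong χ x≈1))
    (𝕂.trans ∑X-⟨1⟩ (𝕂.sym (𝕂.trans (*-congˡ (∑F.δ-≈ x≈1)) (𝕂.*-identityʳ _))))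
  ... | inj₂ x≉1 = 𝕂.trans (∑X-⟨⟩-vanishes x≉1)
    (𝕂.sym (𝕂.trans (*-congˡ (∑F.δ-≉ x≉1)) (𝕂.zeroʳ _)))

  1/[q-1] : 𝕂.Carrier
  1/[q-1] = 𝕂.1/ (q ∸ 1)

  1/[q-1]-inverse : 1/[q-1] * [q-1] ≈ 1#
  1/[q-1]-inverse = lemma (q ∸ 1)
    where
    lemma : ∀ n .{{_ : NonZero n}} → (𝕂.1/ n) * (n 𝕂.×ₙ 1#) ≈ 1#
    lemma (suc n) = 𝕂.trans
      (*-congˡ (𝕂.sym (𝕂.trans (𝕂.+-congˡ 𝕂.-0#≈0#) (𝕂.+-identityʳ _))))
      (proj₁ (proj₂ (𝕂.#⇒invertible (𝕂.charZero n))))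

  average-⟨⟩ : ∀ x → 1/[q-1] * ∑X (λ χ → χ ⟨ x ⟩) ≈ δF x F.1#
  average-⟨⟩ x = begin
    1/[q-1] * ∑X (λ χ → χ ⟨ x ⟩)   ≈⟨ *-congˡ (orthogonality x) ⟩
    1/[q-1] * ([q-1] * δF x F.1#)  ≈⟨ 𝕂.*-assoc _ _ _ ⟨
    1/[q-1] * [q-1] * δF x F.1#    ≈⟨ *-congʳ 1/[q-1]-inverse ⟩
    1# * δF x F.1#                 ≈⟨ 𝕂.*-identityˡ _ ⟩
    δF x F.1#                      ∎

  -- Inversion in the finite field and a transformation of Jacobi sums

  inv : F.Carrier → F.Carrier
  inv x with toSum (x F.≟ F.0#)
  -- With this default value `inv` is an involution of the whole field, as `∑-reindex` requires of a
  -- substitution built from it.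
  ... | inj₁ _   = F.0#
  ... | inj₂ x≉0 = proj₁ (F.≉0⇒invertible x x≉0)

  inv-zero : ∀ {x} → x F.≈ F.0# → inv x F.≈ F.0#
  inv-zero {x} x≈0 with toSum (x F.≟ F.0#)
  ... | inj₁ _   = F.refl
  ... | inj₂ x≉0 = contradiction x≈0 x≉0

  inv-inverse : ∀ {x} → ¬ x F.≈ F.0# → x F.* inv x F.≈ F.1#
  inv-inverse {x} x≉0 with toSum (x F.≟ F.0#)
  ... | inj₁ x≈0 = contradiction x≈0 x≉0
  ... | inj₂ x≉0 = proj₂ (proj₂ (F.≉0⇒invertible x x≉0))

  inverse-unique : ∀ {x y z} → x F.* y F.≈ F.1# → x F.* z F.≈ F.1# → y F.≈ z
  inverse-unique {x} {y} {z} xy≈1 xz≈1 = F.trans (F.sym (F.*-identityʳ y))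
    (F.trans (F.*-congˡ (F.sym xz≈1)) (F.trans (F.sym (F.*-assoc y x z))
    (F.trans (F.*-congʳ (F.trans (F.*-comm y x) xy≈1)) (F.*-identityˡ z))))

  inv-cong : ∀ {x y} → x F.≈ y → inv x F.≈ inv y
  inv-cong {x} {y} x≈y with toSum (y F.≟ F.0#)
  ... | inj₁ y≈0 = inv-zero (F.trans x≈y y≈0)
  ... | inj₂ y≉0 = inverse-unique {x}
    (inv-inverse (λ x≈0 → y≉0 (F.trans (F.sym x≈y) x≈0)))
    (F.trans (F.*-congʳ x≈y) (proj₂ (proj₂ (F.≉0⇒invertible y y≉0))))

  inv-involutive : ∀ x → inv (inv x) F.≈ x
  inv-involutive x = lemma (toSum (x F.≟ F.0#))
    where
    lemma : x F.≈ F.0# ⊎ ¬ x F.≈ F.0# → inv (inv x) F.≈ x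
    lemma (inj₁ x≈0) = F.trans (inv-zero (inv-zero x≈0)) (F.sym x≈0)
    lemma (inj₂ x≉0) = inverse-unique (inv-inverse (*≈1⇒≉0 {inv x} {x} x⁻¹x≈1)) x⁻¹x≈1
      where
      x⁻¹x≈1 : inv x F.* x F.≈ F.1#
      x⁻¹x≈1 = F.trans (F.*-comm (inv x) x) (inv-inverse x≉0)

  1-_ : F.Carrier → F.Carrier
  1- x = F.1# F.- x

  1-cong : ∀ {x y} → x F.≈ y → 1- x F.≈ 1- y
  1-cong x≈y = F.+-congˡ (F.-‿cong x≈y)

  1-involutive : ∀ x → 1- (1- x) F.≈ x
  1-involutive x = F.trans (F.+-congʳ (F.sym 1-x+x≈1)) (F.xyx⁻¹≈y (1- x) x)
    where
    1-x+x≈1 : (1- x) F.+ x F.≈ F.1#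
    1-x+x≈1 = F.trans (F.+-assoc _ _ _)
      (F.trans (F.+-congˡ (F.-‿inverseˡ x)) (F.+-identityʳ F.1#))

  1-inverse : ∀ {s y} → s F.* y F.≈ F.1# → 1- y F.≈ F.- (y F.* (1- s))
  1-inverse {s} {y} sy≈1 = F.sym (F.trans
    (F.-‿cong (F.trans (F.distribˡ y F.1# (F.- s)) (F.+-cong (F.*-identityʳ y)
      (F.trans (F.sym (F.-‿distribʳ-* y s)) (F.-‿cong (F.trans (F.*-comm y s) sy≈1))))))
    (F.⁻¹-anti-homo-// y F.1#))

  ⟨1-⟩-inverse : ∀ χ {s y} → s F.* y F.≈ F.1# →
    χ ⟨ 1- y ⟩ ≈ χ ⟨ -1F ⟩ * (χ ⟨ y ⟩ * χ ⟨ 1- s ⟩)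
  ⟨1-⟩-inverse χ {s} {y} sy≈1 = 𝕂.trans (⟨⟩-cong χ (1-inverse sy≈1))
    (𝕂.trans (⟨-⟩ χ (y F.* (1- s))) (*-congˡ (⟨⟩-* χ y (1- s))))

  -- The substitution u ↦ u / (u - 1), which exchanges 1 - u with its inverse.
  J-transform : ∀ A B → J A B ≈ A ⟨ -1F ⟩ * J A (A ⁻¹ · B ⁻¹)
  J-transform A B = begin
    ∑𝔽 (λ u → A ⟨ u ⟩ * B ⟨ 1- u ⟩)   ≈⟨ ∑F.∑-cong (λ u → pointwise u (toSum (1- u F.≟ F.0#))) ⟩
    ∑𝔽 (λ u → a * f (φ u))            ≈⟨ ∑F.*-∑ a (λ u → f (φ u)) ⟨
    a * ∑𝔽 (λ u → f (φ u))
      ≈⟨ *-congˡ (∑F.∑-reindex f f-cong φ φ φ-cong φ-cong φ-involutive φ-involutive) ⟩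
    a * ∑𝔽 f                          ∎
    where
    D = A ⁻¹ · B ⁻¹
    a = A ⟨ -1F ⟩
    φ : F.Carrier → F.Carrier
    φ u = 1- inv (1- u)
    φ-cong : ∀ {x y} → x F.≈ y → φ x F.≈ φ y
    φ-cong x≈y = 1-cong (inv-cong (1-cong x≈y))
    φ-involutive : ∀ x → φ (φ x) F.≈ x
    φ-involutive x = F.trans (1-cong (F.trans (inv-cong (1-involutive (inv (1- x))))
      (inv-involutive (1- x)))) (1-involutive x)
    f : F.Carrier → 𝕂.Carrier
    f u = A ⟨ u ⟩ * D ⟨ 1- u ⟩
    f-cong : ∀ {x y} → x F.≈ y → f x ≈ f y
    f-cong x≈y = *-cong (⟨⟩-cong A x≈y) (⟨⟩-cong D (1-cong x≈y))
    pointwise : ∀ u → 1- u F.≈ F.0# ⊎ ¬ 1- u F.≈ F.0# →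
      A ⟨ u ⟩ * B ⟨ 1- u ⟩ ≈ a * f (φ u)
    pointwise u (inj₁ t≈0) = 𝕂.trans (𝕂.trans (*-congˡ (⟨⟩-zero B t≈0)) (𝕂.zeroʳ _))
      (𝕂.sym (𝕂.trans (*-congˡ (𝕂.trans (*-congˡ (⟨⟩-zero D
        (F.trans (1-involutive _) (inv-zero t≈0)))) (𝕂.zeroʳ _))) (𝕂.zeroʳ a)))
    pointwise u (inj₂ t≉0) = 𝕂.sym (begin
      a * (A ⟨ 1- w ⟩ * D ⟨ 1- (1- w) ⟩)
        ≈⟨ *-congˡ (*-cong (⟨1-⟩-inverse A {t} {w} tw≈1)
             (𝕂.trans (⟨⟩-cong D (1-involutive w))
               (𝕂.trans (·-⟨⟩ (A ⁻¹) (B ⁻¹) w) (*-cong (⁻¹-⟨⟩ A wt≈1) (⁻¹-⟨⟩ B wt≈1))))) ⟩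
      a * (a * (A ⟨ w ⟩ * A ⟨ 1- t ⟩) * (A ⟨ t ⟩ * B ⟨ t ⟩))
        ≈⟨ solve 5 (λ a x y z b → a ⊕ ((a ⊕ (x ⊕ y)) ⊕ (z ⊕ b)) ⊜ ((a ⊕ a) ⊕ (x ⊕ z)) ⊕ (y ⊕ b))
             𝕂.refl a (A ⟨ w ⟩) (A ⟨ 1- t ⟩) (A ⟨ t ⟩) (B ⟨ t ⟩) ⟩
      (a * a) * (A ⟨ w ⟩ * A ⟨ t ⟩) * (A ⟨ 1- t ⟩ * B ⟨ t ⟩)
        ≈⟨ *-cong (*-cong (⟨-1⟩²≈1 A) (⟨⟩-inverse A wt≈1)) (*-congʳ (⟨⟩-cong A (1-involutive u))) ⟩
      (1# * 1#) * (A ⟨ u ⟩ * B ⟨ t ⟩)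
        ≈⟨ 𝕂.trans (*-congʳ (𝕂.*-identityˡ 1#)) (𝕂.*-identityˡ _) ⟩
      A ⟨ u ⟩ * B ⟨ t ⟩ ∎)
      where
      t = 1- u
      w = inv t
      tw≈1 : t F.* w F.≈ F.1#
      tw≈1 = inv-inverse t≉0
      wt≈1 : w F.* t F.≈ F.1#
      wt≈1 = F.trans (F.*-comm w t) tw≈1

  -- Averages of binomial coefficients and the binomial theorem

  J-congʳ : ∀ A {B C} → B X.≈ C → J A B ≈ J A C
  J-congʳ A {B} {C} B≈C = ∑F.∑-cong (λ u → *-congˡ {A ⟨ u ⟩} (⟨⟩-ext {B} {C} B≈C (1- u)))

  -- The analogue of the beta integrand u^(b-1) (1-u)^(c-b-1).
  kernel : Character → Character → F.Carrier → 𝕂.Carrier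
  kernel B C u = B ⟨ u ⟩ * (B ⁻¹ · C) ⟨ 1- u ⟩

  -- `J-transform` turns the second character of the Jacobi sum into the quotient of C · χ by B · χ,
  -- where χ cancels; χ survives only in χ(u), and the two signs χ(-1) multiply to 1. Keeping D
  -- apart from C · χ allows C = ε with D = χ, as `binomial-theorem` needs.
  binom-·-expansion : ∀ B C χ D → D X.≈ C · χ →
    binom (B · χ) D ≈ B ⟨ -1F ⟩ * C ⟨ -1F ⟩ * ∑𝔽 (λ u → kernel B C u * χ ⟨ u ⟩)
  binom-·-expansion B C χ D D≈Cχ = begin
    D ⟨ -1F ⟩ * J (B · χ) (D ⁻¹)
      ≈⟨ *-cong (𝕂.trans (⟨⟩-ext {D} {C · χ} D≈Cχ -1F) (·-⟨⟩ C χ -1F))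
           (J-transform (B · χ) (D ⁻¹)) ⟩
    C- * χ- * ((B · χ) ⟨ -1F ⟩ * J (B · χ) ((B · χ) ⁻¹ · D ⁻¹ ⁻¹))
      ≈⟨ *-congˡ (*-cong (·-⟨⟩ B χ -1F) (J-congʳ (B · χ) {(B · χ) ⁻¹ · D ⁻¹ ⁻¹} {B ⁻¹ · C} quotient)) ⟩
    C- * χ- * (B- * χ- * J (B · χ) (B ⁻¹ · C))
      ≈⟨ solve 4 (λ b c x j → (c ⊕ x) ⊕ ((b ⊕ x) ⊕ j) ⊜ (x ⊕ x) ⊕ ((b ⊕ c) ⊕ j))
           𝕂.refl B- C- χ- (J (B · χ) (B ⁻¹ · C)) ⟩
    χ- * χ- * (B- * C- * J (B · χ) (B ⁻¹ · C))
      ≈⟨ 𝕂.trans (*-congʳ (⟨-1⟩²≈1 χ)) (𝕂.*-identityˡ _) ⟩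
    B- * C- * J (B · χ) (B ⁻¹ · C)
      ≈⟨ *-congˡ (∑F.∑-cong (λ u → 𝕂.trans (*-congʳ (·-⟨⟩ B χ u))
           (solve 3 (λ x y z → (x ⊕ y) ⊕ z ⊜ (x ⊕ z) ⊕ y) 𝕂.refl
             (B ⟨ u ⟩) (χ ⟨ u ⟩) ((B ⁻¹ · C) ⟨ 1- u ⟩)))) ⟩
    B- * C- * ∑𝔽 (λ u → kernel B C u * χ ⟨ u ⟩) ∎
    where
    B- = B ⟨ -1F ⟩
    C- = C ⟨ -1F ⟩
    χ- = χ ⟨ -1F ⟩
    quotient : (B · χ) ⁻¹ · D ⁻¹ ⁻¹ X.≈ B ⁻¹ · C
    quotient u with ⟦ B ⟧ u | ⟦ C ⟧ u | ⟦ χ ⟧ u | ⟦ D ⟧ u | D≈Cχ u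
    ... | _ , b′ , _ | c , _ | x , x′ , x′x≈1 , _ | d , _ | d≈cx = begin
      b′ * x′ * d         ≈⟨ *-congˡ d≈cx ⟩
      b′ * x′ * (c * x)
        ≈⟨ solve 4 (λ b y c x → (b ⊕ y) ⊕ (c ⊕ x) ⊜ (y ⊕ x) ⊕ (b ⊕ c)) 𝕂.refl b′ x′ c x ⟩
      x′ * x * (b′ * c)   ≈⟨ *-congʳ x′x≈1 ⟩
      1# * (b′ * c)       ≈⟨ 𝕂.*-identityˡ _ ⟩
      b′ * c              ∎

  ∑F-zero : ∑𝔽 (λ _ → 0#) ≈ 0#
  ∑F-zero = CommutativeMonoidSum.sum-replicate-zero
    𝕂.+-commutativeMonoid q

  ∑X∑F-comm : ∀ (f : Character → F.Carrier → 𝕂.Carrier) →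
    ∑X (λ χ → ∑𝔽 (λ u → f χ u)) ≈ ∑𝔽 (λ u → ∑X (λ χ → f χ u))
  ∑X∑F-comm f = CommutativeMonoidSum.∑-comm
    𝕂.+-commutativeMonoid {size} {q}
    (λ i j → f (Inverse.to characters i) (Inverse.to F.elements j))

  average : (Character → 𝕂.Carrier) → 𝕂.Carrier
  average f = 1/[q-1] * ∑X f

  average-cong : ∀ {f g : Character → 𝕂.Carrier} → (∀ χ → f χ ≈ g χ) → average f ≈ average g
  average-cong f≈g = *-congˡ (∑X.∑-cong f≈g)

  average-* : ∀ a (f : Character → 𝕂.Carrier) → average (λ χ → a * f χ) ≈ a * average f
  average-* a f = begin
    1/[q-1] * ∑X (λ χ → a * f χ)  ≈⟨ *-congˡ (∑X.*-∑ a f) ⟨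
    1/[q-1] * (a * ∑X f)
      ≈⟨ solve 3 (λ x y z → x ⊕ (y ⊕ z) ⊜ y ⊕ (x ⊕ z)) 𝕂.refl 1/[q-1] a (∑X f) ⟩
    a * (1/[q-1] * ∑X f)          ∎

  -- The exchange of an average over characters with a sum over the field that `binomial-theorem`,
  -- `hypergeometric` and `average-term` share; κ and w hold the factors independent of χ.
  average-∑F : ∀ (g : Character → 𝕂.Carrier) κ (w : F.Carrier → 𝕂.Carrier)
    (h : F.Carrier → Character → 𝕂.Carrier) →
    average (λ χ → g χ * (κ * ∑𝔽 (λ u → w u * h u χ))) ≈
    κ * ∑𝔽 (λ u → w u * average (λ χ → g χ * h u χ))
  average-∑F g κ w h = begin
    average (λ χ → g χ * (κ * ∑𝔽 (λ u → w u * h u χ)))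
      ≈⟨ average-cong (λ χ → solve 3 (λ x y z → x ⊕ (y ⊕ z) ⊜ y ⊕ (x ⊕ z)) 𝕂.refl
           (g χ) κ (∑𝔽 (λ u → w u * h u χ))) ⟩
    average (λ χ → κ * (g χ * ∑𝔽 (λ u → w u * h u χ)))
      ≈⟨ average-* κ (λ χ → g χ * ∑𝔽 (λ u → w u * h u χ)) ⟩
    κ * average (λ χ → g χ * ∑𝔽 (λ u → w u * h u χ))
      ≈⟨ *-congˡ (average-cong (λ χ → 𝕂.trans (∑F.*-∑ (g χ) (λ u → w u * h u χ))
           (∑F.∑-cong (λ u → solve 3 (λ x y z → x ⊕ (y ⊕ z) ⊜ y ⊕ (x ⊕ z)) 𝕂.refl
             (g χ) (w u) (h u χ))))) ⟩
    κ * average (λ χ → ∑𝔽 (λ u → w u * (g χ * h u χ)))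
      ≈⟨ *-congˡ (*-congˡ (∑X∑F-comm (λ χ u → w u * (g χ * h u χ)))) ⟩
    κ * (1/[q-1] * ∑𝔽 (λ u → ∑X (λ χ → w u * (g χ * h u χ))))
      ≈⟨ *-congˡ (∑F.*-∑ 1/[q-1] (λ u → ∑X (λ χ → w u * (g χ * h u χ)))) ⟩
    κ * ∑𝔽 (λ u → average (λ χ → w u * (g χ * h u χ)))
      ≈⟨ *-congˡ (∑F.∑-cong (λ u → average-* (w u) (λ χ → g χ * h u χ))) ⟩
    κ * ∑𝔽 (λ u → w u * average (λ χ → g χ * h u χ)) ∎

  -- For x nonzero only s = 1/x contributes, and 1 - 1/x = -(1 - x)/x lets β be evaluated by
  -- multiplicativity. For x = 0 no s contributes, in agreement with α⁻¹(0) = 0.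
  ∑F-sift-inverse : ∀ α β x → ∑𝔽 (λ s → α ⟨ s ⟩ * β ⟨ 1- s ⟩ * δF (s F.* x) F.1#) ≈
    β ⟨ -1F ⟩ * ((α ⁻¹) ⟨ x ⟩ * (β ⁻¹) ⟨ x ⟩ * β ⟨ 1- x ⟩)
  ∑F-sift-inverse α β x = lemma (toSum (x F.≟ F.0#))
    where
    b = β ⟨ -1F ⟩
    y = inv x
    f : F.Carrier → 𝕂.Carrier
    f s = α ⟨ s ⟩ * β ⟨ 1- s ⟩
    lemma : x F.≈ F.0# ⊎ ¬ x F.≈ F.0# → ∑𝔽 (λ s → f s * δF (s F.* x) F.1#) ≈
      b * ((α ⁻¹) ⟨ x ⟩ * (β ⁻¹) ⟨ x ⟩ * β ⟨ 1- x ⟩)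
    lemma (inj₁ x≈0) = begin
      ∑𝔽 (λ s → f s * δF (s F.* x) F.1#)
        ≈⟨ ∑F.∑-cong (λ s → 𝕂.trans (*-congˡ (∑F.δ-≉ (λ sx≈1 → F.0≉1 (F.trans
             (F.sym (F.trans (F.*-congˡ x≈0) (F.zeroʳ s))) sx≈1)))) (𝕂.zeroʳ (f s))) ⟩
      ∑𝔽 (λ _ → 0#)
        ≈⟨ ∑F-zero ⟩
      0#
        ≈⟨ 𝕂.trans (*-congˡ (𝕂.trans (*-congʳ (𝕂.trans (*-congʳ (⟨⟩-zero (α ⁻¹) x≈0))
             (𝕂.zeroˡ _))) (𝕂.zeroˡ _))) (𝕂.zeroʳ b) ⟨
      b * ((α ⁻¹) ⟨ x ⟩ * (β ⁻¹) ⟨ x ⟩ * β ⟨ 1- x ⟩) ∎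
    lemma (inj₂ x≉0) = begin
      ∑𝔽 (λ s → f s * δF (s F.* x) F.1#)
        ≈⟨ ∑F.∑-cong (λ s → *-congˡ {f s} (δ-inverse s (toSum (s F.≟ y)))) ⟩
      ∑𝔽 (λ s → f s * δF s y)
        ≈⟨ ∑F.∑-sift f y (λ s≈y → *-cong (⟨⟩-cong α s≈y) (⟨⟩-cong β (1-cong s≈y))) ⟩
      α ⟨ y ⟩ * β ⟨ 1- y ⟩
        ≈⟨ 𝕂.*-identityˡ _ ⟨
      1# * (α ⟨ y ⟩ * β ⟨ 1- y ⟩)
        ≈⟨ *-congʳ (𝕂.trans (*-cong (⟨-1⟩²≈1 β) (⟨⟩-inverse β yx≈1)) (𝕂.*-identityˡ 1#)) ⟨
      b * b * (β ⟨ y ⟩ * β ⟨ x ⟩) * (α ⟨ y ⟩ * β ⟨ 1- y ⟩)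
        ≈⟨ solve 5 (λ b y x a z → ((b ⊕ b) ⊕ (y ⊕ x)) ⊕ (a ⊕ z) ⊜ b ⊕ ((a ⊕ y) ⊕ (b ⊕ (x ⊕ z))))
             𝕂.refl b (β ⟨ y ⟩) (β ⟨ x ⟩) (α ⟨ y ⟩) (β ⟨ 1- y ⟩) ⟩
      b * (α ⟨ y ⟩ * β ⟨ y ⟩ * (b * (β ⟨ x ⟩ * β ⟨ 1- y ⟩)))
        ≈⟨ *-congˡ (*-cong (*-cong (⁻¹-⟨⟩ α xy≈1) (⁻¹-⟨⟩ β xy≈1)) (⟨1-⟩-inverse β yx≈1)) ⟨
      b * ((α ⁻¹) ⟨ x ⟩ * (β ⁻¹) ⟨ x ⟩ * β ⟨ 1- x ⟩) ∎
      where
      xy≈1 : x F.* y F.≈ F.1#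
      xy≈1 = inv-inverse x≉0
      yx≈1 : y F.* x F.≈ F.1#
      yx≈1 = F.trans (F.*-comm y x) xy≈1
      δ-inverse : ∀ s → s F.≈ y ⊎ ¬ s F.≈ y → δF (s F.* x) F.1# ≈ δF s y
      δ-inverse s (inj₁ s≈y) =
        𝕂.trans (∑F.δ-≈ (F.trans (F.*-congʳ s≈y) yx≈1)) (𝕂.sym (∑F.δ-≈ s≈y))
      δ-inverse s (inj₂ s≉y) = 𝕂.trans
        (∑F.δ-≉ (λ sx≈1 → s≉y (inverse-unique {x} (F.trans (F.*-comm x s) sx≈1) xy≈1)))
        (𝕂.sym (∑F.δ-≉ s≉y))

  ⁻¹-⟨-1⟩ : ∀ χ → (χ ⁻¹) ⟨ -1F ⟩ ≈ χ ⟨ -1F ⟩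
  ⁻¹-⟨-1⟩ χ = ⁻¹-⟨⟩ χ -1*-1≈1

  -- The analogue of the binomial series of (1 - x)^(-a). After `binom-·-expansion` with C = ε,
  -- orthogonality leaves only u = 1/x. The factor `ε ⟨ x ⟩` accounts for x = 0, where every term on
  -- the left vanishes but A⁻¹(1) = 1.
  binomial-theorem : ∀ A x →
    average (λ χ → binom (A · χ) χ * χ ⟨ x ⟩) ≈ ε ⟨ x ⟩ * (A ⁻¹) ⟨ 1- x ⟩
  binomial-theorem A x = begin
    average (λ χ → binom (A · χ) χ * χ ⟨ x ⟩)
      ≈⟨ average-cong (λ χ → 𝕂.trans (𝕂.*-comm (binom (A · χ) χ) (χ ⟨ x ⟩))
           (*-congˡ {χ ⟨ x ⟩} (binom-·-expansion A ε χ χ (λ u → 𝕂.sym (𝕂.*-identityˡ _))))) ⟩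
    average (λ χ → χ ⟨ x ⟩ * (κ * ∑𝔽 (λ u → kernel A ε u * χ ⟨ u ⟩)))
      ≈⟨ average-∑F (λ χ → χ ⟨ x ⟩) κ (kernel A ε) (λ u χ → χ ⟨ u ⟩) ⟩
    κ * ∑𝔽 (λ u → kernel A ε u * average (λ χ → χ ⟨ x ⟩ * χ ⟨ u ⟩))
      ≈⟨ *-congˡ {κ} (∑F.∑-cong (λ u → *-congˡ {kernel A ε u} (delta u))) ⟩
    κ * ∑𝔽 (λ u → kernel A ε u * δF (u F.* x) F.1#)
      ≈⟨ *-congˡ {κ} (∑F-sift-inverse A β x) ⟩
    κ * (β ⟨ -1F ⟩ * ((A ⁻¹) ⟨ x ⟩ * (β ⁻¹) ⟨ x ⟩ * β ⟨ 1- x ⟩))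
      ≈⟨ *-cong (*-congˡ {a} (ε-⟨⟩ (*≈1⇒≉0 -1*-1≈1)))
           (*-cong (𝕂.trans (β≈ -1F) (⁻¹-⟨-1⟩ A))
             (*-cong (*-congˡ (⟨⟩-ext {β ⁻¹} {A} (λ u → 𝕂.*-identityʳ _) x)) (β≈ (1- x)))) ⟩
    a * 1# * (a * ((A ⁻¹) ⟨ x ⟩ * A ⟨ x ⟩ * (A ⁻¹) ⟨ 1- x ⟩))
      ≈⟨ *-cong (𝕂.*-identityʳ a) (*-congˡ {a} (*-congʳ (⁻¹·-⟨⟩ A x))) ⟩
    a * (a * (ε ⟨ x ⟩ * (A ⁻¹) ⟨ 1- x ⟩))
      ≈⟨ 𝕂.*-assoc a a _ ⟨
    a * a * (ε ⟨ x ⟩ * (A ⁻¹) ⟨ 1- x ⟩)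
      ≈⟨ 𝕂.trans (*-congʳ (⟨-1⟩²≈1 A)) (𝕂.*-identityˡ _) ⟩
    ε ⟨ x ⟩ * (A ⁻¹) ⟨ 1- x ⟩ ∎
    where
    a = A ⟨ -1F ⟩
    κ = a * ε ⟨ -1F ⟩
    β = A ⁻¹ · ε
    β≈ : ∀ z → β ⟨ z ⟩ ≈ (A ⁻¹) ⟨ z ⟩
    β≈ = ⟨⟩-ext {β} {A ⁻¹} (λ u → 𝕂.*-identityʳ _)
    delta : ∀ u → average (λ χ → χ ⟨ x ⟩ * χ ⟨ u ⟩) ≈ δF (u F.* x) F.1#
    delta u = 𝕂.trans
      (average-cong (λ χ → 𝕂.trans (𝕂.*-comm (χ ⟨ x ⟩) (χ ⟨ u ⟩)) (𝕂.sym (⟨⟩-* χ u x))))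
      (average-⟨⟩ (u F.* x))

  -- Euler integrals and their degenerate case

  sign : Character → Character → 𝕂.Carrier
  sign B C = B ⟨ -1F ⟩ * C ⟨ -1F ⟩

  -- The Euler integral of the ₂F₁ character sum.
  hypergeometric : ∀ A B C y →
    average (λ ψ → binom (A · ψ) ψ * binom (B · ψ) (C · ψ) * ψ ⟨ y ⟩) ≈
    sign B C * ∑𝔽 (λ v → kernel B C v * (ε ⟨ v F.* y ⟩ * (A ⁻¹) ⟨ 1- (v F.* y) ⟩))
  hypergeometric A B C y = begin
    average (λ ψ → b ψ * binom (B · ψ) (C · ψ) * ψ ⟨ y ⟩)
      ≈⟨ average-cong (λ ψ → 𝕂.trans
           (solve 3 (λ x y z → (x ⊕ y) ⊕ z ⊜ (x ⊕ z) ⊕ y) 𝕂.refl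
             (b ψ) (binom (B · ψ) (C · ψ)) (ψ ⟨ y ⟩))
           (*-congˡ {b ψ * ψ ⟨ y ⟩} (binom-·-expansion B C ψ (C · ψ) (λ u → 𝕂.refl)))) ⟩
    average (λ ψ → b ψ * ψ ⟨ y ⟩ * (sign B C * ∑𝔽 (λ v → kernel B C v * ψ ⟨ v ⟩)))
      ≈⟨ average-∑F (λ ψ → b ψ * ψ ⟨ y ⟩) (sign B C) (kernel B C) (λ v ψ → ψ ⟨ v ⟩) ⟩
    sign B C * ∑𝔽 (λ v → kernel B C v * average (λ ψ → b ψ * ψ ⟨ y ⟩ * ψ ⟨ v ⟩))
      ≈⟨ *-congˡ {sign B C} (∑F.∑-cong (λ v → *-congˡ {kernel B C v} (inner v))) ⟩
    sign B C * ∑𝔽 (λ v → kernel B C v * (ε ⟨ v F.* y ⟩ * (A ⁻¹) ⟨ 1- (v F.* y) ⟩)) ∎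
    where
    b : Character → 𝕂.Carrier
    b ψ = binom (A · ψ) ψ
    inner : ∀ v → average (λ ψ → b ψ * ψ ⟨ y ⟩ * ψ ⟨ v ⟩) ≈
      ε ⟨ v F.* y ⟩ * (A ⁻¹) ⟨ 1- (v F.* y) ⟩
    inner v = 𝕂.trans
      (average-cong (λ ψ → 𝕂.trans
        (solve 3 (λ x y z → (x ⊕ y) ⊕ z ⊜ x ⊕ (z ⊕ y)) 𝕂.refl (b ψ) (ψ ⟨ y ⟩) (ψ ⟨ v ⟩))
        (*-congˡ {b ψ} (𝕂.sym (⟨⟩-* ψ v y)))))
      (binomial-theorem A (v F.* y))

  average-zero : average (λ _ → 0#) ≈ 0#
  average-zero = 𝕂.trans (*-congˡ ∑X-zero) (𝕂.zeroʳ 1/[q-1])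

  -- The sum in `hypergeometric` made homogeneous: 1 is replaced by z, which will be 1 - v y and may
  -- be 0.
  eulerSum : (A B C : Character) (x z : F.Carrier) → 𝕂.Carrier
  eulerSum A B C x z =
    ∑𝔽 (λ u → kernel B C u * (ε ⟨ u F.* x ⟩ * (A ⁻¹) ⟨ z F.- u F.* x ⟩))

  eulerSum-cong : ∀ A B C x {z z′} → z F.≈ z′ → eulerSum A B C x z ≈ eulerSum A B C x z′
  eulerSum-cong A B C x z≈z′ = ∑F.∑-cong (λ u → *-congˡ {kernel B C u}
    (*-congˡ {ε ⟨ u F.* x ⟩} (⟨⟩-cong (A ⁻¹) (F.+-congʳ {F.- (u F.* x)} z≈z′))))

  -- For z nonzero, divide by z: χ(1/z) turns χ(x) into χ(x/z), and A(1/z) = A⁻¹(z) turns A⁻¹(1 - u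
  -- x/z) into A⁻¹(z - u x). For z = 0 the left side vanishes because every character does at 0,
  -- while `eulerSum` at 0 need not; hence the factor `ε ⟨ z ⟩`, from which the correction term
  -- arises.
  hypergeometric-homogeneous : ∀ A B C x z →
    average (λ χ → binom (A · χ) χ * binom (B · χ) (C · χ) * χ ⟨ x ⟩ * ((A · χ) ⁻¹) ⟨ z ⟩) ≈
    ε ⟨ z ⟩ * (sign B C * eulerSum A B C x z)
  hypergeometric-homogeneous A B C x z = lemma (toSum (z F.≟ F.0#))
    where
    b : Character → 𝕂.Carrier
    b χ = binom (A · χ) χ * binom (B · χ) (C · χ)
    w = inv z
    lemma : z F.≈ F.0# ⊎ ¬ z F.≈ F.0# →
      average (λ χ → b χ * χ ⟨ x ⟩ * ((A · χ) ⁻¹) ⟨ z ⟩) ≈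
      ε ⟨ z ⟩ * (sign B C * eulerSum A B C x z)
    lemma (inj₁ z≈0) = 𝕂.trans
      (average-cong (λ χ → 𝕂.trans (*-congˡ {b χ * χ ⟨ x ⟩} (⟨⟩-zero ((A · χ) ⁻¹) z≈0)) (𝕂.zeroʳ _)))
      (𝕂.trans average-zero (𝕂.sym (𝕂.trans (*-congʳ (⟨⟩-zero ε z≈0)) (𝕂.zeroˡ _))))
    lemma (inj₂ z≉0) = begin
      average (λ χ → b χ * χ ⟨ x ⟩ * ((A · χ) ⁻¹) ⟨ z ⟩)
        ≈⟨ average-cong rescale ⟩
      average (λ χ → A ⟨ w ⟩ * (b χ * χ ⟨ x F.* w ⟩))
        ≈⟨ average-* (A ⟨ w ⟩) (λ χ → b χ * χ ⟨ x F.* w ⟩) ⟩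
      A ⟨ w ⟩ * average (λ χ → b χ * χ ⟨ x F.* w ⟩)
        ≈⟨ *-congˡ {A ⟨ w ⟩} (hypergeometric A B C (x F.* w)) ⟩
      A ⟨ w ⟩ * (sign B C * ∑𝔽 (λ u → kernel B C u * e u))
        ≈⟨ solve 3 (λ x y z → x ⊕ (y ⊕ z) ⊜ y ⊕ (x ⊕ z)) 𝕂.refl
             (A ⟨ w ⟩) (sign B C) (∑𝔽 (λ u → kernel B C u * e u)) ⟩
      sign B C * (A ⟨ w ⟩ * ∑𝔽 (λ u → kernel B C u * e u))
        ≈⟨ *-congˡ {sign B C} (∑F.*-∑ (A ⟨ w ⟩) (λ u → kernel B C u * e u)) ⟩
      sign B C * ∑𝔽 (λ u → A ⟨ w ⟩ * (kernel B C u * e u))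
        ≈⟨ *-congˡ {sign B C} (∑F.∑-cong (λ u → 𝕂.trans
             (solve 3 (λ x y z → x ⊕ (y ⊕ z) ⊜ y ⊕ (x ⊕ z)) 𝕂.refl (A ⟨ w ⟩) (kernel B C u) (e u))
             (*-congˡ {kernel B C u} (pointwise u)))) ⟩
      sign B C * eulerSum A B C x z
        ≈⟨ 𝕂.trans (*-congʳ (ε-⟨⟩ z≉0)) (𝕂.*-identityˡ _) ⟨
      ε ⟨ z ⟩ * (sign B C * eulerSum A B C x z) ∎
      where
      e : F.Carrier → 𝕂.Carrier
      e u = ε ⟨ u F.* (x F.* w) ⟩ * (A ⁻¹) ⟨ 1- (u F.* (x F.* w)) ⟩
      zw≈1 : z F.* w F.≈ F.1#
      zw≈1 = inv-inverse z≉0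
      wz≈1 : w F.* z F.≈ F.1#
      wz≈1 = F.trans (F.*-comm w z) zw≈1
      rescale : ∀ χ → b χ * χ ⟨ x ⟩ * ((A · χ) ⁻¹) ⟨ z ⟩ ≈ A ⟨ w ⟩ * (b χ * χ ⟨ x F.* w ⟩)
      rescale χ = begin
        b χ * χ ⟨ x ⟩ * ((A · χ) ⁻¹) ⟨ z ⟩
          ≈⟨ *-congˡ {b χ * χ ⟨ x ⟩} (𝕂.trans (⁻¹-⟨⟩ (A · χ) zw≈1) (·-⟨⟩ A χ w)) ⟩
        b χ * χ ⟨ x ⟩ * (A ⟨ w ⟩ * χ ⟨ w ⟩)
          ≈⟨ solve 4 (λ b x a y → (b ⊕ x) ⊕ (a ⊕ y) ⊜ a ⊕ (b ⊕ (x ⊕ y))) 𝕂.refl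
               (b χ) (χ ⟨ x ⟩) (A ⟨ w ⟩) (χ ⟨ w ⟩) ⟩
        A ⟨ w ⟩ * (b χ * (χ ⟨ x ⟩ * χ ⟨ w ⟩))
          ≈⟨ *-congˡ {A ⟨ w ⟩} (*-congˡ {b χ} (⟨⟩-* χ x w)) ⟨
        A ⟨ w ⟩ * (b χ * χ ⟨ x F.* w ⟩) ∎
      scale : ∀ u → z F.* (1- (u F.* (x F.* w))) F.≈ z F.- u F.* x
      scale u = F.trans (F.distribˡ z F.1# _) (F.+-cong (F.*-identityʳ z)
        (F.trans (F.sym (F.-‿distribʳ-* z (u F.* (x F.* w)))) (F.-‿cong (F.trans
          (F.*-comm z _) (F.trans (F.*-congʳ (F.sym (F.*-assoc u x w)))
          (F.trans (F.*-assoc (u F.* x) w z) (F.trans (F.*-congˡ wz≈1) (F.*-identityʳ _))))))))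
      pointwise : ∀ u → A ⟨ w ⟩ * e u ≈ ε ⟨ u F.* x ⟩ * (A ⁻¹) ⟨ z F.- u F.* x ⟩
      pointwise u = begin
        A ⟨ w ⟩ * (ε ⟨ u F.* (x F.* w) ⟩ * (A ⁻¹) ⟨ t ⟩)
          ≈⟨ *-congˡ {A ⟨ w ⟩} (*-congʳ (𝕂.trans (⟨⟩-cong ε (F.sym (F.*-assoc u x w)))
               (⟨⟩-* ε (u F.* x) w))) ⟩
        A ⟨ w ⟩ * (ε ⟨ u F.* x ⟩ * ε ⟨ w ⟩ * (A ⁻¹) ⟨ t ⟩)
          ≈⟨ solve 4 (λ a e f b → a ⊕ ((e ⊕ f) ⊕ b) ⊜ e ⊕ ((f ⊕ a) ⊕ b)) 𝕂.refl
               (A ⟨ w ⟩) (ε ⟨ u F.* x ⟩) (ε ⟨ w ⟩) ((A ⁻¹) ⟨ t ⟩) ⟩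
        ε ⟨ u F.* x ⟩ * (ε ⟨ w ⟩ * A ⟨ w ⟩ * (A ⁻¹) ⟨ t ⟩)
          ≈⟨ *-congˡ {ε ⟨ u F.* x ⟩} (*-congʳ (𝕂.trans (ε-absorb A w) (𝕂.sym (⁻¹-⟨⟩ A zw≈1)))) ⟩
        ε ⟨ u F.* x ⟩ * ((A ⁻¹) ⟨ z ⟩ * (A ⁻¹) ⟨ t ⟩)
          ≈⟨ *-congˡ {ε ⟨ u F.* x ⟩} (𝕂.trans (𝕂.sym (⟨⟩-* (A ⁻¹) z t)) (⟨⟩-cong (A ⁻¹) (scale u))) ⟩
        ε ⟨ u F.* x ⟩ * (A ⁻¹) ⟨ z F.- u F.* x ⟩ ∎
        where t = 1- (u F.* (x F.* w))

  -- At z = 0 the last factor A⁻¹(-u x) splits into A⁻¹(-x) A⁻¹(u), and A⁻¹(u) joins B(u) to form a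
  -- Jacobi sum. The factors ε are absorbed by B(u) and A⁻¹(-x).
  eulerSum-0 : ∀ A B C x →
    eulerSum A B C x F.0# ≈ (A ⁻¹) ⟨ F.- x ⟩ * J (A ⁻¹ · B) (B ⁻¹ · C)
  eulerSum-0 A B C x = 𝕂.trans (∑F.∑-cong pointwise)
    (𝕂.sym (∑F.*-∑ ((A ⁻¹) ⟨ F.- x ⟩) (λ u → (A ⁻¹ · B) ⟨ u ⟩ * (B ⁻¹ · C) ⟨ 1- u ⟩)))
    where
    0-ux : ∀ u → F.0# F.- u F.* x F.≈ (F.- x) F.* u
    0-ux u = F.trans (F.+-identityˡ _) (F.trans (F.-‿cong (F.*-comm u x)) (F.-‿distribˡ-* x u))
    a-x = (A ⁻¹) ⟨ F.- x ⟩
    absorb : ε ⟨ x ⟩ * a-x ≈ a-x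
    absorb = 𝕂.trans (*-congˡ {ε ⟨ x ⟩} (⟨-⟩ (A ⁻¹) x)) (𝕂.trans
      (solve 3 (λ e a b → e ⊕ (a ⊕ b) ⊜ a ⊕ (e ⊕ b)) 𝕂.refl
        (ε ⟨ x ⟩) ((A ⁻¹) ⟨ -1F ⟩) ((A ⁻¹) ⟨ x ⟩))
      (𝕂.trans (*-congˡ {(A ⁻¹) ⟨ -1F ⟩} (ε-absorb (A ⁻¹) x)) (𝕂.sym (⟨-⟩ (A ⁻¹) x))))
    pointwise : ∀ u →
      kernel B C u * (ε ⟨ u F.* x ⟩ * (A ⁻¹) ⟨ F.0# F.- u F.* x ⟩) ≈
      a-x * ((A ⁻¹ · B) ⟨ u ⟩ * (B ⁻¹ · C) ⟨ 1- u ⟩)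
    pointwise u = begin
      b * β * (ε ⟨ u F.* x ⟩ * (A ⁻¹) ⟨ F.0# F.- u F.* x ⟩)
        ≈⟨ *-congˡ {b * β} (*-cong (⟨⟩-* ε u x)
             (𝕂.trans (⟨⟩-cong (A ⁻¹) (0-ux u)) (⟨⟩-* (A ⁻¹) (F.- x) u))) ⟩
      b * β * (ε ⟨ u ⟩ * ε ⟨ x ⟩ * (a-x * a))
        ≈⟨ solve 6 (λ b β e f x a → (b ⊕ β) ⊕ ((e ⊕ f) ⊕ (x ⊕ a)) ⊜ (f ⊕ x) ⊕ ((a ⊕ (e ⊕ b)) ⊕ β))
             𝕂.refl b β (ε ⟨ u ⟩) (ε ⟨ x ⟩) a-x a ⟩
      ε ⟨ x ⟩ * a-x * (a * (ε ⟨ u ⟩ * b) * β)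
        ≈⟨ *-cong absorb (*-congʳ (𝕂.trans (*-congˡ {a} (ε-absorb B u)) (𝕂.sym (·-⟨⟩ (A ⁻¹) B u)))) ⟩
      a-x * ((A ⁻¹ · B) ⟨ u ⟩ * β) ∎
      where
      a = (A ⁻¹) ⟨ u ⟩
      b = B ⟨ u ⟩
      β = (B ⁻¹ · C) ⟨ 1- u ⟩

  -- Of the two coefficients exactly one is 1 and the other 0, according to whether t = 1. This
  -- separates what the character sum sees from the correction.
  split-zero : ∀ (f : F.Carrier → 𝕂.Carrier) → (∀ {x y} → x F.≈ y → f x ≈ f y) → ∀ t →
    f (1- t) ≈ ε ⟨ 1- t ⟩ * f (1- t) + δF t F.1# * f F.0#
  split-zero f f-cong t = lemma (toSum (t F.≟ F.1#))
    where
    lemma : t F.≈ F.1# ⊎ ¬ t F.≈ F.1# →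
      f (1- t) ≈ ε ⟨ 1- t ⟩ * f (1- t) + δF t F.1# * f F.0#
    lemma (inj₁ t≈1) = 𝕂.trans (f-cong 1-t≈0) (𝕂.sym (𝕂.trans
      (𝕂.+-cong (𝕂.trans (*-congʳ (⟨⟩-zero ε 1-t≈0)) (𝕂.zeroˡ _))
        (𝕂.trans (*-congʳ (∑F.δ-≈ t≈1)) (𝕂.*-identityˡ _)))
      (𝕂.+-identityˡ _)))
      where
      1-t≈0 : 1- t F.≈ F.0#
      1-t≈0 = F.trans (1-cong t≈1) (F.-‿inverseʳ F.1#)
    lemma (inj₂ t≉1) = 𝕂.sym (𝕂.trans
      (𝕂.+-cong (𝕂.trans (*-congʳ (ε-⟨⟩ 1-t≉0)) (𝕂.*-identityˡ _))
        (𝕂.trans (*-congʳ (∑F.δ-≉ t≉1)) (𝕂.zeroˡ _)))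
      (𝕂.+-identityʳ _))
      where
      1-t≉0 : ¬ 1- t F.≈ F.0#
      1-t≉0 1-t≈0 = t≉1 (F.sym (F.x∙y⁻¹≈ε⇒x≈y F.1# t 1-t≈0))

  -- The expansion of F₂

  module _ (A B B′ C C′ : Character) (x y : F.Carrier) where

    κ κ′ : 𝕂.Carrier
    κ  = sign B C
    κ′ = sign B′ C′

    weight : F.Carrier → 𝕂.Carrier
    weight v = kernel B′ C′ v * ε ⟨ v F.* y ⟩

    remainder : F.Carrier → F.Carrier
    remainder v = 1- (v F.* y)

    inner : F.Carrier → 𝕂.Carrier
    inner z = κ * eulerSum A B C x z

    -- The factor ε(x y) is ε(x) ε(y). Combined with ε(u) and ε(v), which B(u) and B′(v) absorb, it
    -- yields the ε(u x) of `eulerSum` and the ε(v y) of `weight`. The rest is regrouping and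
    -- exchanging the two sums.
    F₂-as-iterated-sum :
      F₂ A B B′ C C′ x y ≈ κ′ * ∑𝔽 (λ v → weight v * inner (remainder v))
    F₂-as-iterated-sum = begin
      e * ∑𝔽 (λ u → ∑𝔽 (λ v → T u v))
        ≈⟨ *-congˡ {e} (CommutativeMonoidSum.∑-comm
             𝕂.+-commutativeMonoid {q} {q}
             (λ i j → T (Inverse.to F.elements i) (Inverse.to F.elements j))) ⟩
      e * ∑𝔽 (λ v → ∑𝔽 (λ u → T u v))
        ≈⟨ ∑F.*-∑ e (λ v → ∑𝔽 (λ u → T u v)) ⟩
      ∑𝔽 (λ v → e * ∑𝔽 (λ u → T u v))
        ≈⟨ ∑F.∑-cong column ⟩
      ∑𝔽 (λ v → κ′ * (weight v * inner (remainder v)))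
        ≈⟨ ∑F.*-∑ κ′ (λ v → weight v * inner (remainder v)) ⟨
      κ′ * ∑𝔽 (λ v → weight v * inner (remainder v)) ∎
      where
      e = ε ⟨ x F.* y ⟩ * (B · B′ · C · C′) ⟨ -1F ⟩
      T : F.Carrier → F.Carrier → 𝕂.Carrier
      T u v = B ⟨ u ⟩ * B′ ⟨ v ⟩ * (B ⁻¹ · C) ⟨ F.1# F.- u ⟩ *
        (B′ ⁻¹ · C′) ⟨ F.1# F.- v ⟩ * (A ⁻¹) ⟨ F.1# F.- u F.* x F.- v F.* y ⟩
      g : F.Carrier → F.Carrier → 𝕂.Carrier
      g v u = ε ⟨ u F.* x ⟩ * (A ⁻¹) ⟨ remainder v F.- u F.* x ⟩

      swap : ∀ u v → F.1# F.- u F.* x F.- v F.* y F.≈ remainder v F.- u F.* x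
      swap u v = F.trans (F.+-assoc F.1# _ _)
        (F.trans (F.+-congˡ (F.+-comm _ _)) (F.sym (F.+-assoc F.1# _ _)))

      e≈ : e ≈ ε ⟨ x ⟩ * ε ⟨ y ⟩ * (κ′ * κ)
      e≈ = begin
        e
          ≈⟨ *-cong (⟨⟩-* ε x y) (𝕂.trans (·-⟨⟩ (B · B′ · C) C′ -1F)
               (*-congʳ (𝕂.trans (·-⟨⟩ (B · B′) C -1F) (*-congʳ (·-⟨⟩ B B′ -1F))))) ⟩
        ε ⟨ x ⟩ * ε ⟨ y ⟩ * (B ⟨ -1F ⟩ * B′ ⟨ -1F ⟩ * C ⟨ -1F ⟩ * C′ ⟨ -1F ⟩)
          ≈⟨ *-congˡ {ε ⟨ x ⟩ * ε ⟨ y ⟩} (solve 4 (λ b b′ c c′ →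
               ((b ⊕ b′) ⊕ c) ⊕ c′ ⊜ (b′ ⊕ c′) ⊕ (b ⊕ c)) 𝕂.refl
               (B ⟨ -1F ⟩) (B′ ⟨ -1F ⟩) (C ⟨ -1F ⟩) (C′ ⟨ -1F ⟩)) ⟩
        ε ⟨ x ⟩ * ε ⟨ y ⟩ * (κ′ * κ) ∎

      pointwise : ∀ v u → e * T u v ≈ κ′ * (weight v * κ) * (kernel B C u * g v u)
      pointwise v u = begin
        e * (b * b′ * β * β′ * (A ⁻¹) ⟨ F.1# F.- u F.* x F.- v F.* y ⟩)
          ≈⟨ *-cong e≈ (*-cong (*-congʳ (*-congʳ (*-cong
               (𝕂.sym (ε-absorb B u)) (𝕂.sym (ε-absorb B′ v)))))
               (⟨⟩-cong (A ⁻¹) (swap u v))) ⟩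
        ε ⟨ x ⟩ * ε ⟨ y ⟩ * (κ′ * κ) * (ε ⟨ u ⟩ * b * (ε ⟨ v ⟩ * b′) * β * β′ * r)
          ≈⟨ solve 11 (λ ex ey k′ k eu b ev b′ β β′ r →
               ((ex ⊕ ey) ⊕ (k′ ⊕ k)) ⊕ (((((eu ⊕ b) ⊕ (ev ⊕ b′)) ⊕ β) ⊕ β′) ⊕ r) ⊜
               (k′ ⊕ (((b′ ⊕ β′) ⊕ (ev ⊕ ey)) ⊕ k)) ⊕ ((b ⊕ β) ⊕ ((eu ⊕ ex) ⊕ r)))
               𝕂.refl (ε ⟨ x ⟩) (ε ⟨ y ⟩) κ′ κ (ε ⟨ u ⟩) b (ε ⟨ v ⟩) b′ β β′ r ⟩
        κ′ * (b′ * β′ * (ε ⟨ v ⟩ * ε ⟨ y ⟩) * κ) * (b * β * (ε ⟨ u ⟩ * ε ⟨ x ⟩ * r))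
          ≈⟨ *-cong (*-congˡ {κ′} (*-congʳ (*-congˡ {b′ * β′} (⟨⟩-* ε v y))))
               (*-congˡ {b * β} (*-congʳ (⟨⟩-* ε u x))) ⟨
        κ′ * (weight v * κ) * (kernel B C u * g v u) ∎
        where
        b = B ⟨ u ⟩
        b′ = B′ ⟨ v ⟩
        β = (B ⁻¹ · C) ⟨ 1- u ⟩
        β′ = (B′ ⁻¹ · C′) ⟨ 1- v ⟩
        r = (A ⁻¹) ⟨ remainder v F.- u F.* x ⟩

      column : ∀ v → e * ∑𝔽 (λ u → T u v) ≈ κ′ * (weight v * inner (remainder v))
      column v = begin
        e * ∑𝔽 (λ u → T u v)         ≈⟨ ∑F.*-∑ e (λ u → T u v) ⟩
        ∑𝔽 (λ u → e * T u v)         ≈⟨ ∑F.∑-cong (pointwise v) ⟩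
        ∑𝔽 (λ u → κ′ * (weight v * κ) * (kernel B C u * g v u))
          ≈⟨ ∑F.*-∑ (κ′ * (weight v * κ)) (λ u → kernel B C u * g v u) ⟨
        κ′ * (weight v * κ) * eulerSum A B C x (remainder v)
          ≈⟨ solve 4 (λ a b c d → (a ⊕ (b ⊕ c)) ⊕ d ⊜ a ⊕ (b ⊕ (c ⊕ d))) 𝕂.refl
               κ′ (weight v) κ (eulerSum A B C x (remainder v)) ⟩
        κ′ * (weight v * inner (remainder v)) ∎

    term : Character → Character → 𝕂.Carrier
    term χ ψ = binom (A · χ) χ * binom (A · χ · ψ) ψ * binom (B · χ) (C · χ) *
      binom (B′ · ψ) (C′ · ψ) * χ ⟨ x ⟩ * ψ ⟨ y ⟩

    -- Averaging over ψ first is `hypergeometric` with A · χ in place of A and leaves the inverse of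
    -- A · χ at 1 - v y. Once the sum over v is moved outside, the average over χ is
    -- `hypergeometric-homogeneous` at z = 1 - v y.
    average-term : 1/[q-1] 𝕂.^ 2 * ∑X (λ χ → ∑X (λ ψ → term χ ψ)) ≈
      κ′ * ∑𝔽 (λ v → weight v * (ε ⟨ remainder v ⟩ * inner (remainder v)))
    average-term = begin
      1/[q-1] 𝕂.^ 2 * ∑X (λ χ → ∑X (term χ))
        ≈⟨ *-congʳ (*-congˡ {1/[q-1]} (𝕂.*-identityʳ 1/[q-1])) ⟩
      1/[q-1] * 1/[q-1] * ∑X (λ χ → ∑X (term χ))
        ≈⟨ 𝕂.*-assoc 1/[q-1] 1/[q-1] (∑X (λ χ → ∑X (term χ))) ⟩
      1/[q-1] * average (λ χ → ∑X (term χ))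
        ≈⟨ average-* 1/[q-1] (λ χ → ∑X (term χ)) ⟨
      average (λ χ → average (term χ))
        ≈⟨ average-cong rowAverage ⟩
      average (λ χ → g χ * (κ′ * ∑𝔽 (λ v → weight v * h v χ)))
        ≈⟨ average-∑F g κ′ weight h ⟩
      κ′ * ∑𝔽 (λ v → weight v * average (λ χ → g χ * h v χ))
        ≈⟨ *-congˡ {κ′} (∑F.∑-cong (λ v → *-congˡ {weight v}
             (hypergeometric-homogeneous A B C x (remainder v)))) ⟩
      κ′ * ∑𝔽 (λ v → weight v * (ε ⟨ remainder v ⟩ * inner (remainder v))) ∎
      where
      g : Character → 𝕂.Carrier
      g χ = binom (A · χ) χ * binom (B · χ) (C · χ) * χ ⟨ x ⟩
      h : F.Carrier → Character → 𝕂.Carrier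
      h v χ = ((A · χ) ⁻¹) ⟨ remainder v ⟩
      rowAverage : ∀ χ → average (term χ) ≈ g χ * (κ′ * ∑𝔽 (λ v → weight v * h v χ))
      rowAverage χ = begin
        average (term χ)
          ≈⟨ average-cong (λ ψ → solve 6 (λ a b c d x y →
               ((((a ⊕ b) ⊕ c) ⊕ d) ⊕ x) ⊕ y ⊜ ((a ⊕ c) ⊕ x) ⊕ ((b ⊕ d) ⊕ y)) 𝕂.refl
               (binom (A · χ) χ) (binom (A · χ · ψ) ψ) (binom (B · χ) (C · χ))
               (binom (B′ · ψ) (C′ · ψ)) (χ ⟨ x ⟩) (ψ ⟨ y ⟩)) ⟩
        average (λ ψ → g χ * f ψ)
          ≈⟨ average-* (g χ) f ⟩
        g χ * average f
          ≈⟨ *-congˡ {g χ} (hypergeometric (A · χ) B′ C′ y) ⟩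
        g χ * (κ′ * ∑𝔽 (λ v → kernel B′ C′ v * (ε ⟨ v F.* y ⟩ * h v χ)))
          ≈⟨ *-congˡ {g χ} (*-congˡ {κ′} (∑F.∑-cong (λ v →
               𝕂.*-assoc (kernel B′ C′ v) (ε ⟨ v F.* y ⟩) (h v χ)))) ⟨
        g χ * (κ′ * ∑𝔽 (λ v → weight v * h v χ)) ∎
        where
        f : Character → 𝕂.Carrier
        f ψ = binom (A · χ · ψ) ψ * binom (B′ · ψ) (C′ · ψ) * ψ ⟨ y ⟩

    -- The terms with v y = 1 are those the character sum does not see.
    boundary : κ′ * ∑𝔽 (λ v → weight v * (δF (v F.* y) F.1# * inner F.0#)) ≈
      (A ⁻¹) ⟨ F.- x ⟩ * (C′ ⁻¹) ⟨ y ⟩ * (B′ ⁻¹ · C′) ⟨ 1- y ⟩ * binom (A ⁻¹ · B) (B · C ⁻¹)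
    boundary = begin
      κ′ * ∑𝔽 (λ v → weight v * (δF (v F.* y) F.1# * i))
        ≈⟨ *-congˡ {κ′} (∑F.∑-cong pointwise) ⟩
      κ′ * ∑𝔽 (λ v → kernel B′ C′ v * δF (v F.* y) F.1# * i)
        ≈⟨ *-congˡ {κ′} (∑F.∑-* i (λ v → kernel B′ C′ v * δF (v F.* y) F.1#)) ⟨
      κ′ * (∑𝔽 (λ v → kernel B′ C′ v * δF (v F.* y) F.1#) * i)
        ≈⟨ *-congˡ {κ′} (*-congʳ (∑F-sift-inverse B′ β y)) ⟩
      κ′ * (β ⟨ -1F ⟩ * ((B′ ⁻¹) ⟨ y ⟩ * (β ⁻¹) ⟨ y ⟩ * β ⟨ 1- y ⟩) * i)
        ≈⟨ *-congˡ {κ′} (*-cong (*-cong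
             (𝕂.trans (·-⟨⟩ (B′ ⁻¹) C′ -1F) (*-congʳ (⁻¹-⟨-1⟩ B′)))
             (*-congʳ (𝕂.trans (𝕂.sym (·-⟨⟩ (B′ ⁻¹) (β ⁻¹) y))
               (⟨⟩-ext {B′ ⁻¹ · β ⁻¹} {C′ ⁻¹} quotient y))))
             (*-congˡ {κ} (eulerSum-0 A B C x))) ⟩
      κ′ * (κ′ * (c′ * β ⟨ 1- y ⟩) * (κ * (a * j)))
        ≈⟨ solve 6 (λ k′ c b k a j → k′ ⊕ ((k′ ⊕ (c ⊕ b)) ⊕ (k ⊕ (a ⊕ j))) ⊜
             (k′ ⊕ k′) ⊕ (((a ⊕ c) ⊕ b) ⊕ (k ⊕ j))) 𝕂.refl κ′ c′ (β ⟨ 1- y ⟩) κ a j ⟩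
      κ′ * κ′ * (a * c′ * β ⟨ 1- y ⟩ * (κ * j))
        ≈⟨ 𝕂.trans (*-congʳ κ′²≈1) (𝕂.*-identityˡ _) ⟩
      a * c′ * β ⟨ 1- y ⟩ * (κ * j)
        ≈⟨ *-congˡ {a * c′ * β ⟨ 1- y ⟩} (*-cong
             (𝕂.trans (·-⟨⟩ B (C ⁻¹) -1F) (*-congˡ {B ⟨ -1F ⟩} (⁻¹-⟨-1⟩ C)))
             (J-congʳ (A ⁻¹ · B) {(B · C ⁻¹) ⁻¹} {B ⁻¹ · C} (λ u → 𝕂.refl))) ⟨
      a * c′ * β ⟨ 1- y ⟩ * binom (A ⁻¹ · B) (B · C ⁻¹) ∎
      where
      i = inner F.0#
      β = B′ ⁻¹ · C′
      a = (A ⁻¹) ⟨ F.- x ⟩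
      c′ = (C′ ⁻¹) ⟨ y ⟩
      j = J (A ⁻¹ · B) (B ⁻¹ · C)
      quotient : B′ ⁻¹ · β ⁻¹ X.≈ C′ ⁻¹
      quotient u with ⟦ B′ ⟧ u | ⟦ C′ ⟧ u
      ... | b , b′ , b′b≈1 , _ | _ , c′ , _ =
        𝕂.trans (𝕂.sym (𝕂.*-assoc b′ b c′)) (𝕂.trans (*-congʳ b′b≈1) (𝕂.*-identityˡ c′))
      κ′²≈1 : κ′ * κ′ ≈ 1#
      κ′²≈1 = 𝕂.trans
        (solve 2 (λ b c → (b ⊕ c) ⊕ (b ⊕ c) ⊜ (b ⊕ b) ⊕ (c ⊕ c)) 𝕂.refl (B′ ⟨ -1F ⟩) (C′ ⟨ -1F ⟩))
        (𝕂.trans (*-cong (⟨-1⟩²≈1 B′) (⟨-1⟩²≈1 C′)) (𝕂.*-identityˡ 1#))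
      ε-δ : ∀ t → t F.≈ F.1# ⊎ ¬ t F.≈ F.1# → ε ⟨ t ⟩ * δF t F.1# ≈ δF t F.1#
      ε-δ t (inj₁ t≈1) = 𝕂.trans (*-congʳ (⟨1⟩ ε t≈1)) (𝕂.*-identityˡ _)
      ε-δ t (inj₂ t≉1) =
        𝕂.trans (*-congˡ {ε ⟨ t ⟩} (∑F.δ-≉ t≉1)) (𝕂.trans (𝕂.zeroʳ _) (𝕂.sym (∑F.δ-≉ t≉1)))
      pointwise : ∀ v → weight v * (δF (v F.* y) F.1# * i) ≈
        kernel B′ C′ v * δF (v F.* y) F.1# * i
      pointwise v = 𝕂.trans
        (solve 4 (λ k e d i → (k ⊕ e) ⊕ (d ⊕ i) ⊜ (k ⊕ (e ⊕ d)) ⊕ i) 𝕂.refl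
          (kernel B′ C′ v) (ε ⟨ v F.* y ⟩) (δF (v F.* y) F.1#) i)
        (*-congʳ (*-congˡ {kernel B′ C′ v} (ε-δ (v F.* y) (toSum (v F.* y F.≟ F.1#)))))

    F₂-expansion : F₂ A B B′ C C′ x y ≈
      1/[q-1] 𝕂.^ 2 * ∑X (λ χ → ∑X (λ ψ → term χ ψ)) +
      (A ⁻¹) ⟨ F.- x ⟩ * (C′ ⁻¹) ⟨ y ⟩ * (B′ ⁻¹ · C′) ⟨ 1- y ⟩ * binom (A ⁻¹ · B) (B · C ⁻¹)
    F₂-expansion = begin
      F₂ A B B′ C C′ x y
        ≈⟨ F₂-as-iterated-sum ⟩
      κ′ * ∑𝔽 (λ v → weight v * inner (remainder v))
        -- Splitting at t = v y gives `bulk`, in the form reached by `average-term`, and `rest`, in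
        -- the form evaluated by `boundary`.
        ≈⟨ *-congˡ {κ′} (∑F.∑-cong (λ v → 𝕂.trans
             (*-congˡ {weight v} (split-zero inner inner-cong (v F.* y)))
             (𝕂.distribˡ (weight v) _ _))) ⟩
      κ′ * ∑𝔽 (λ v → bulk v + rest v)
        ≈⟨ *-congˡ {κ′} (∑F.∑-+ bulk rest) ⟩
      κ′ * (∑𝔽 bulk + ∑𝔽 rest)
        ≈⟨ 𝕂.distribˡ κ′ (∑𝔽 bulk) (∑𝔽 rest) ⟩
      κ′ * ∑𝔽 bulk + κ′ * ∑𝔽 rest
        ≈⟨ 𝕂.+-cong (𝕂.sym average-term) boundary ⟩
      _ ∎
      where
      bulk rest : F.Carrier → 𝕂.Carrier
      bulk v = weight v * (ε ⟨ remainder v ⟩ * inner (remainder v))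
      rest v = weight v * (δF (v F.* y) F.1# * inner F.0#)
      inner-cong : ∀ {z z′} → z F.≈ z′ → inner z ≈ inner z′
      inner-cong z≈z′ = *-congˡ {κ} (eulerSum-cong A B C x z≈z′)

theorem1p3 :
  ∀ {c ℓ k ℓ₁ ℓ₂ : Level} (q : ℕ) (q-primePower : IsPrimePower q)
    (𝔽 : FiniteField c ℓ q) (K : AlgClosedCharZeroField k ℓ₁ ℓ₂) →
  let module F = FiniteField 𝔽
      open AlgClosedCharZeroField K
      open Characters 𝔽 K
  in
  (E : CharacterEnumeration) →
  let open CharacterEnumeration E using (∑χ) in
  (A B B′ C C′ : Character) (x y : F.Carrier) →
  F₂ A B B′ C C′ x y
    ≈ (1/ (q ∸ 1)) {{primePower⇒q∸1≢0 q-primePower}} ^ 2 *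
      ∑χ (λ χ → ∑χ (λ ψ →
        binom (A · χ) χ * binom (A · χ · ψ) ψ *
        binom (B · χ) (C · χ) * binom (B′ · ψ) (C′ · ψ) *
        χ ⟨ x ⟩ * ψ ⟨ y ⟩))
      + (A ⁻¹) ⟨ F.- x ⟩ * (C′ ⁻¹) ⟨ y ⟩ * (B′ ⁻¹ · C′) ⟨ F.1# F.- y ⟩ *
        binom (A ⁻¹ · B) (B · C ⁻¹)
theorem1p3 q q-primePower 𝔽 K E =
  AppellExpansion.F₂-expansion 𝔽 K E {{primePower⇒q∸1≢0 q-primePower}}
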